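{- Let $a>b$ be relatively prime positive integers and let $\omega(a,b)=\underbrace{RR\cdots R}_{a}\underbrace{UU\cdots U}_{b}$. Then $\omega(a,b)\in\mathcal{D}(a,b)$, and it is the unique maximal element of $\mathcal{D}(a,b)$ with respect to both orderings $<_M$ and $<_L$; that is, for every $\omega\in\mathcal{D}(a,b)$ with $\omega\neq\omega(a,b)$ we have $M(\omega)<M(\omega(a,b))$ and $L(\omega)<L(\omega(a,b))$.
   Context: A lattice path from $(0,0)$ to $(a,b)$ is a word $w_1w_2\cdots w_{a+b}$ in the letters $R$ (unit step right) and $U$ (unit step up) containing $a$ letters $R$ and $b$ letters $U$. $\mathcal{D}(a,b)$ denotes the set of such paths lying (weakly) below the diagonal line $y=\frac{b}{a}x$. For a word $W=w_1\cdots w_n$ in $R,U$, let $f(W)=[a_0,a_1,\ldots,a_t]$ be the finite continued fraction whose entry sequence is obtained by scanning $i=1,\ldots,n-1$ in order and appending $1,1$ if $w_i=w_{i+1}$ and appending $2$ if $w_i\neq w_{i+1}$. The numerator of a finite continued fraction $[c_0,\ldots,c_t]$ is $p_t$, where $p_{ -2}=0$, $p_{ -1}=1$, $p_i=c_ip_{i-1}+p_{i-2}$. Define $M(\omega)$ to be the numerator of $f(\omega)$ (equivalently, by Çanakçı–Schiffler, the number of perfect matchings of the snake graph of $\omega$). Let $g(\omega)=[\overline{2,a_0,a_1,\ldots,a_t}]$ be the infinite purely periodic continued fraction with period $(2,a_0,\ldots,a_t)$, where $f(\omega)=[a_0,\ldots,a_t]$. For an irrational $\alpha$, its Lagrange number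 is $L(\alpha)=\sup\{L:\ |\frac{p}{q}-\alpha|<\frac{1}{Lq^2}\text{ for infinitely many reduced fractions }\frac pq\}$, and $L(\omega):=L(g(\omega))$. The orderings are: $\omega<_M\omega'$ iff $M(\omega)<M(\omega')$, and $\omega<_L\omega'$ iff $L(\omega)<L(\omega')$. -}

module Defs where

open import Data.Nat using (ℕ; zero; suc; _+_; _*_; _≤_; _<_; _%_)
open import Data.Nat.Coprimality using (Coprime)
open import Data.Integer as ℤ using (ℤ; +_; ∣_∣)
open import Data.List using (List; []; _∷_; _++_; replicate; length; inits)
open import Data.List.Relation.Unary.All using (All)
open import Data.Product using (_×_; _,_; ∃; ∃-syntax; proj₁; proj₂)
open import Relation.Binary.PropositionalEquality using (_≡_)

data Step : Set where
  R U : Step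

Word : Set
Word = List Step

countR : Word → ℕ
countR []      = 0
countR (R ∷ w) = suc (countR w)
countR (U ∷ w) = countR w

countU : Word → ℕ
countU []      = 0
countU (R ∷ w) = countU w
countU (U ∷ w) = suc (countU w)

-- every lattice point visited (every prefix, i.e. point (x,y)) satisfies
-- y ≤ (b/a) x, i.e. a*y ≤ b*x.  (Checking vertices suffices since the
-- path is piecewise linear between lattice points.)
BelowDiag : ℕ → ℕ → Word → Set
BelowDiag a b w = All (λ u → a * countU u ≤ b * countR u) (inits w)

InD : ℕ → ℕ → Word → Set
InD a b w = (countR w ≡ a) × (countU w ≡ b) × BelowDiag a b w

omegaAB : ℕ → ℕ → Word
omegaAB a b = replicate a R ++ replicate b U

sameStep : Step → Step → List ℕ
sameStep R R = 1 ∷ 1 ∷ []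
sameStep U U = 1 ∷ 1 ∷ []
sameStep R U = 2 ∷ []
sameStep U R = 2 ∷ []

fEntries : Word → List ℕ
fEntries (x ∷ y ∷ rest) = sameStep x y ++ fEntries (y ∷ rest)
fEntries _              = []

-- numerator p_t with p_{-2} = 0, p_{-1} = 1, p_i = c_i p_{i-1} + p_{i-2}
numerAux : ℕ → ℕ → List ℕ → ℕ
numerAux pp p []       = p
numerAux pp p (c ∷ cs) = numerAux p (c * p + pp) cs

numerator : List ℕ → ℕ
numerator = numerAux 0 1

M : Word → ℕ
M w = numerator (fEntries w)

-- The infinite periodic continued fraction g(W) = [overline{2, a_0,...,a_t}]

nth : List ℕ → ℕ → ℕ
nth []       _       = 0
nth (x ∷ xs) zero    = x
nth (x ∷ xs) (suc k) = nth xs k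

gEntry : Word → ℕ → ℕ
gEntry w k = nth (2 ∷ fEntries w) (k % suc (length (fEntries w)))

-- convergents of [c_0; c_1, c_2, ...]:
-- cfPQ c k = ((p_{k-1}, q_{k-1}) , (p_k , q_k)), p_{-1}=1, q_{-1}=0
cfPQ : (ℕ → ℕ) → ℕ → (ℕ × ℕ) × (ℕ × ℕ)
cfPQ c zero = (1 , 0) , (c 0 , 1)
cfPQ c (suc k) with cfPQ c k
... | (p' , q') , (p , q) = (p , q) , (c (suc k) * p + p' , c (suc k) * q + q')

convP : (ℕ → ℕ) → ℕ → ℕ
convP c k = proj₁ (proj₂ (cfPQ c k))

convQ : (ℕ → ℕ) → ℕ → ℕ
convQ c k = proj₂ (proj₂ (cfPQ c k))

-- The real number α = [c_0; c_1, ...] (limit of the convergents; even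
-- convergents increase to α, odd ones decrease to α) is represented by its
-- Dedekind cut: comparisons with rationals A/B (A ∈ ℤ, B > 0).
-- A/B < α  iff  A/B < p_{2k}/q_{2k} for some k
RatBelow : (ℕ → ℕ) → ℤ → ℕ → Set
RatBelow c A B = ∃[ k ] (A ℤ.* + convQ c (2 * k) ℤ.< + convP c (2 * k) ℤ.* + B)

RatAbove : (ℕ → ℕ) → ℤ → ℕ → Set
RatAbove c A B = ∃[ k ] (+ convP c (suc (2 * k)) ℤ.* + B ℤ.< A ℤ.* + convQ c (suc (2 * k)))

-- For the positive rational L = m/n (m,n ≥ 1):
-- |p/q - α| < 1/(L q²) holds for infinitely many reduced fractions p/q,
-- i.e. for reduced fractions with arbitrarily large denominator.
-- |p/q - α| < n/(m q²)  iff  (p m q - n)/(m q²) < α < (p m q + n)/(m q²).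
Approximable : (ℕ → ℕ) → ℕ → ℕ → Set
Approximable c m n =
  ∀ (N : ℕ) → ∃[ p ] ∃[ q ]
    ( N < q
    × Coprime ∣ p ∣ q
    × RatBelow c (p ℤ.* + m ℤ.* + q ℤ.- + n) (m * q * q)
    × RatAbove c (p ℤ.* + m ℤ.* + q ℤ.+ + n) (m * q * q))

-- L(α) < L(β), where L(·) = sup of the (downward closed) set of admissible L.
-- sup S_α < sup S_β iff there are positive rationals m₁/n₁ < m₂/n₂ with
-- m₂/n₂ admissible for β and m₁/n₁ an upper bound of the rationals
-- admissible for α.
LagrangeLT : (ℕ → ℕ) → (ℕ → ℕ) → Set
LagrangeLT α β =
  ∃[ m₁ ] ∃[ n₁ ] ∃[ m₂ ] ∃[ n₂ ]
    ( 0 < m₁ × 0 < n₁ × 0 < m₂ × 0 < n₂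
    × m₁ * n₂ < m₂ * n₁
    × Approximable β m₂ n₂
    × (∀ m n → 0 < m → 0 < n → Approximable α m n → m * n₁ ≤ m₁ * n))

_<L_ : Word → Word → Set
w <L w' = LagrangeLT (gEntry w) (gEntry w')

{-# OPTIONS --safe #-}
-- Numerators. Up to its first and last letter, M is the sum of the entries of the product of the symmetric
-- matrices A_R = (2 1 ; 1 1) and A_U = (1 1 ; 1 2) along the word. Replacing RʳUⁱRʲS by Rʳ⁺ʲUⁱS, where r ≥ 1
-- and S does not start with R, changes the sum by the commutator of A_Rʲ and A_Uⁱ, which is a positive gain.
-- A path of D(a, b) starts with RR and ends with U, so repeating this move leads to RᵃUᵇ.
--
-- Lagrange numbers. Let T x = 1 / (1 + 1 / (1 + x)). Around an entry 2 of the period the two continued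
-- fraction tails are Tʲ⁻¹ [0; 2, …] with j the length of the adjacent run. For ω ≠ RᵃUᵇ every cyclic run of R
-- is shorter than a and every run of U shorter than b; since [0; 2, …] < 1/2 = T 0 and T is increasing, all
-- convergents satisfy 1 / (q |q α - p|) ≤ 2 + Tᵃ⁻¹ 0 + Tᵇ⁻¹ 0; at an entry 1 the left-hand side is at most 3.
-- By Legendre's argument no other fraction does better. For RᵃUᵇ the entry 2 that starts the period has
-- the runs Rᵃ and Uᵇ next to it, so infinitely many convergents give at least 2 + Tᵃ⁻¹ 0 + Tᵇ⁻¹ (1/3).
module Submission where

open import Defs
open import Data.Nat
open import Data.Nat.Properties
open import Data.Nat.Coprimality using (Coprime)
open import Data.Nat.Divisibility using (_∣_; ∣m+n∣m⇒∣n; ∣1⇒≡1; ∣n⇒∣m*n; ∣m⇒∣m*n)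
open import Data.Nat.DivMod using ([m+kn]%n≡m%n; m<n⇒m%n≡m; m%n<n)
open import Data.Nat.Tactic.RingSolver using () renaming (solve-∀ to solveℕ-∀)
open import Data.Integer as ℤ using (ℤ; +_; -[1+_]; ∣_∣)
import Data.Integer.Properties as ℤ
open import Data.Integer.Tactic.RingSolver using () renaming (solve-∀ to solveℤ-∀)
open import Data.List using (List; []; _∷_; _++_; [_]; replicate; length; concat; drop; inits; initLast; _∷ʳ′_)
open import Data.List.Properties using (++-assoc; ++-identityʳ; ∷-injectiveʳ)
open import Data.List.Relation.Unary.All as All using (All; []; _∷_)
open import Data.List.Relation.Unary.All.Properties using (map⁺; map⁻)
open import Data.Product using (_×_; _,_; ∃; proj₁; proj₂; uncurry)
open import Data.Sum using (_⊎_; inj₁; inj₂)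
open import Function using (_∘_)
open import Relation.Nullary using (contradiction)
open import Relation.Binary.PropositionalEquality
  using (_≡_; _≢_; refl; sym; trans; cong; cong₂; subst; subst₂)

-- Numerators as products of letter matrices

Fraction : Set
Fraction = ℕ × ℕ

-- With `(n , d)` read as n / d, this is the map x ↦ 1 / (c + x), and `fr l` is [0; l].
cstep : ℕ → Fraction → Fraction
cstep c (n , d) = d , c * d + n

fr : List ℕ → Fraction
fr []      = 0 , 1
fr (c ∷ l) = cstep c (fr l)

num den : List ℕ → ℕ
num l = proj₁ (fr l)
den l = proj₂ (fr l)

-- The recursion is linear in its two starting values; its coefficients are continuants, which `fr`
-- computes from the other end of the list.
numerAux-fr : ∀ l p' p → numerAux p' p l ≡ den l * p + num l * p'
numerAux-fr [] p' p = e p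
  where
  e : ∀ p → p ≡ 1 * p + 0
  e = solveℕ-∀
numerAux-fr (c ∷ l) p' p = trans (numerAux-fr l p (c * p + p')) (e (den l) (num l) c p p')
  where
  e : ∀ d n c p p' → d * (c * p + p') + n * p ≡ (c * d + n) * p + d * p'
  e = solveℕ-∀

numerator-fr : ∀ l → numerator l ≡ den l
numerator-fr l = trans (numerAux-fr l 0 1) (e (den l) (num l))
  where
  e : ∀ d n → d * 1 + n * 0 ≡ d
  e = solveℕ-∀

letter : Step → ℕ × ℕ → ℕ × ℕ
letter R (x , y) = 2 * x + y , x + y
letter U (x , y) = x + y , x + 2 * y

vec : Word → ℕ × ℕ
vec []      = 1 , 1
vec (s ∷ V) = letter s (vec V)

coord : Step → ℕ × ℕ → ℕ
coord R (x , y) = x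
coord U (x , y) = y

weight : Word → ℕ
weight V = proj₁ (vec V) + proj₂ (vec V)

-- An entry depends on two neighbouring letters, but `vec V` holds the numerators for both possible
-- letters in front of `V`, over the common denominator `weight V`. So each letter acts by a single
-- matrix.
fr-vec : ∀ s V t → fr (fEntries (s ∷ V ++ [ t ])) ≡ (coord s (vec V) , weight V)
fr-vec R [] R = refl
fr-vec R [] U = refl
fr-vec U [] R = refl
fr-vec U [] U = refl
fr-vec R (R ∷ V) t rewrite fr-vec R V t = let x , y = vec V in cong₂ _,_ (e₁ x y) (e₂ x y)
  where
  e₁ : ∀ x y → 1 * (x + y) + x ≡ 2 * x + y
  e₁ = solveℕ-∀
  e₂ : ∀ x y → 1 * (1 * (x + y) + x) + (x + y) ≡ 2 * x + y + (x + y)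
  e₂ = solveℕ-∀
fr-vec R (U ∷ V) t rewrite fr-vec U V t = let x , y = vec V in cong₂ _,_ refl (e₂ x y)
  where
  e₂ : ∀ x y → 2 * (x + y) + y ≡ x + y + (x + 2 * y)
  e₂ = solveℕ-∀
fr-vec U (R ∷ V) t rewrite fr-vec R V t = let x , y = vec V in cong₂ _,_ refl (e₂ x y)
  where
  e₂ : ∀ x y → 2 * (x + y) + x ≡ 2 * x + y + (x + y)
  e₂ = solveℕ-∀
fr-vec U (U ∷ V) t rewrite fr-vec U V t = let x , y = vec V in cong₂ _,_ (e₁ x y) (e₂ x y)
  where
  e₁ : ∀ x y → 1 * (x + y) + y ≡ x + 2 * y
  e₁ = solveℕ-∀
  e₂ : ∀ x y → 1 * (1 * (x + y) + y) + (x + y) ≡ x + y + (x + 2 * y)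
  e₂ = solveℕ-∀

M-weight : ∀ s V t → M (s ∷ V ++ [ t ]) ≡ weight V
M-weight s V t = trans (numerator-fr (fEntries (s ∷ V ++ [ t ]))) (cong proj₂ (fr-vec s V t))

-- actR (q , s) and actU (q , s) apply the matrices (q + s , q ; q , s) and (s , q ; q , q + s);
-- with (q , s) = pow j they are the j-th powers of the matrices of R and of U.
actR actU : ℕ × ℕ → ℕ × ℕ → ℕ × ℕ
actR (q , s) (x , y) = (q + s) * x + q * y , q * x + s * y
actU (q , s) (x , y) = s * x + q * y , q * x + (q + s) * y

pow : ℕ → ℕ × ℕ
pow zero    = 0 , 1
pow (suc j) = let q , s = pow j in 2 * q + s , q + s

private
  identity : ∀ x y → (x , y) ≡ (1 * x + 0 * y , 0 * x + 1 * y)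
  identity x y = cong₂ _,_ (e₁ x y) (e₂ x y)
    where
    e₁ : ∀ x y → x ≡ 1 * x + 0 * y
    e₁ = solveℕ-∀
    e₂ : ∀ x y → y ≡ 0 * x + 1 * y
    e₂ = solveℕ-∀

vec-Rs : ∀ j S → vec (replicate j R ++ S) ≡ actR (pow j) (vec S)
vec-Rs zero    S = uncurry identity (vec S)
vec-Rs (suc j) S rewrite vec-Rs j S = let x , y = vec S in cong₂ _,_ (e₁ q s x y) (e₂ q s x y)
  where
  q = proj₁ (pow j)
  s = proj₂ (pow j)
  e₁ : ∀ q s x y → 2 * ((q + s) * x + q * y) + (q * x + s * y)
      ≡ (2 * q + s + (q + s)) * x + (2 * q + s) * y
  e₁ = solveℕ-∀
  e₂ : ∀ q s x y → (q + s) * x + q * y + (q * x + s * y) ≡ (2 * q + s) * x + (q + s) * y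
  e₂ = solveℕ-∀

vec-Us : ∀ j S → vec (replicate j U ++ S) ≡ actU (pow j) (vec S)
vec-Us zero    S = uncurry identity (vec S)
vec-Us (suc j) S rewrite vec-Us j S = let x , y = vec S in cong₂ _,_ (e₁ q s x y) (e₂ q s x y)
  where
  q = proj₁ (pow j)
  s = proj₂ (pow j)
  e₁ : ∀ q s x y → s * x + q * y + (q * x + (q + s) * y) ≡ (q + s) * x + (2 * q + s) * y
  e₁ = solveℕ-∀
  e₂ : ∀ q s x y → s * x + q * y + 2 * (q * x + (q + s) * y)
      ≡ (2 * q + s) * x + (2 * q + s + (q + s)) * y
  e₂ = solveℕ-∀

pow-pos₂ : ∀ j → 0 < proj₂ (pow j)
pow-pos₂ zero    = s≤s z≤n
pow-pos₂ (suc j) = ≤-trans (pow-pos₂ j) (m≤n+m _ _)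

pow-pos₁ : ∀ j → 0 < proj₁ (pow (suc j))
pow-pos₁ j = ≤-trans (pow-pos₂ j) (m≤n+m _ _)

vec-pos : ∀ S → 0 < proj₁ (vec S)
vec-pos []      = s≤s z≤n
vec-pos (R ∷ S) = ≤-trans (vec-pos S) (≤-trans (m≤m+n _ _) (m≤m+n _ _))
vec-pos (U ∷ S) = ≤-trans (vec-pos S) (m≤m+n _ _)

data NotR : Word → Set where
  empty : NotR []
  isU   : ∀ {S} → NotR (U ∷ S)

-- Of the two matrices only A_R can make the first coordinate the larger one. Swaps are made in
-- front of such words, which makes their gain positive.
vec-NotR : ∀ {S} → NotR S → proj₁ (vec S) ≤ proj₂ (vec S)
vec-NotR empty = ≤-refl
vec-NotR (isU {S}) = +-monoʳ-≤ (proj₁ (vec S)) (m≤m+n _ _)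

total : ℕ × ℕ → ℕ
total (x , y) = x + y

-- The gain is the commutator of the two inner matrices, a multiple of (0 1 ; -1 0),
-- evaluated at the row vector (1 , 1) actR (q , s) and the column vector (x , y).
swap-gain : ∀ {q s q₁ s₁ q₂ s₂ x y} → 0 < q → 0 < q₁ → 0 < q₂ → 0 < x → x ≤ y →
  total (actR (q , s) (actU (q₁ , s₁) (actR (q₂ , s₂) (x , y))))
  < total (actR (q , s) (actR (q₂ , s₂) (actU (q₁ , s₁) (x , y))))
swap-gain {q} {s} {q₁} {s₁} {q₂} {s₂} {x} 0<q 0<q₁ 0<q₂ 0<x x≤y with m≤n⇒∃[o]m+o≡n x≤y
-- With y = x + e the gain becomes an identity without subtraction, whose first summand is a product
-- of positive factors.
... | e , refl = subst (total (actR (q , s) (actU (q₁ , s₁) (actR (q₂ , s₂) (x , x + e)))) <_)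
      (sym (gain q s q₁ s₁ q₂ s₂ x e))
      (m<m+n (total (actR (q , s) (actU (q₁ , s₁) (actR (q₂ , s₂) (x , x + e)))))
        (≤-trans (*-mono-≤ (*-mono-≤ 0<q₁ 0<q₂) (*-mono-≤ 0<q 0<x))
          (m≤m+n (q₁ * q₂ * (q * x)) _)))
  where
  gain : ∀ rq rs iq is jq js x e →
    (rq + rs) * ((jq + js) * (is * x + iq * (x + e)) + jq * (iq * x + (iq + is) * (x + e)))
      + rq * (jq * (is * x + iq * (x + e)) + js * (iq * x + (iq + is) * (x + e)))
      + (rq * ((jq + js) * (is * x + iq * (x + e)) + jq * (iq * x + (iq + is) * (x + e)))
      + rs * (jq * (is * x + iq * (x + e)) + js * (iq * x + (iq + is) * (x + e))))
    ≡ ((rq + rs) * (is * ((jq + js) * x + jq * (x + e)) + iq * (jq * x + js * (x + e)))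
      + rq * (iq * ((jq + js) * x + jq * (x + e)) + (iq + is) * (jq * x + js * (x + e)))
      + (rq * (is * ((jq + js) * x + jq * (x + e)) + iq * (jq * x + js * (x + e)))
      + rs * (iq * ((jq + js) * x + jq * (x + e)) + (iq + is) * (jq * x + js * (x + e)))))
      + (iq * jq * (rq * x) + iq * jq * (rq * x + 2 * (rq * e + (rq + rs) * e)))
  gain = solveℕ-∀

weight-swap : ∀ r i j {S} → NotR S →
  weight (replicate (suc r) R ++ replicate (suc i) U ++ replicate (suc j) R ++ S)
  < weight (replicate (suc r) R ++ replicate (suc j) R ++ replicate (suc i) U ++ S)
weight-swap r i j {S} h = subst₂ _<_ (sym old) (sym new)
  (swap-gain (pow-pos₁ r) (pow-pos₁ i) (pow-pos₁ j) (vec-pos S) (vec-NotR h))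
  where
  old : weight (replicate (suc r) R ++ replicate (suc i) U ++ replicate (suc j) R ++ S)
        ≡ total (actR (pow (suc r)) (actU (pow (suc i)) (actR (pow (suc j)) (vec S))))
  old = cong total (trans (vec-Rs (suc r) _) (cong (actR (pow (suc r)))
          (trans (vec-Us (suc i) _) (cong (actU (pow (suc i))) (vec-Rs (suc j) S)))))
  new : weight (replicate (suc r) R ++ replicate (suc j) R ++ replicate (suc i) U ++ S)
        ≡ total (actR (pow (suc r)) (actR (pow (suc j)) (actU (pow (suc i)) (vec S))))
  new = cong total (trans (vec-Rs (suc r) _) (cong (actR (pow (suc r)))
          (trans (vec-Rs (suc j) _) (cong (actR (pow (suc j))) (vec-Us (suc i) S)))))

-- Sorting a word by swaps

replicate-snoc : ∀ {A : Set} n (x : A) l → replicate n x ++ x ∷ l ≡ x ∷ replicate n x ++ l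
replicate-snoc zero    x l = refl
replicate-snoc (suc n) x l = cong (x ∷_) (replicate-snoc n x l)

replicate-+ : ∀ {A : Set} m n (x : A) l → replicate m x ++ replicate n x ++ l ≡ replicate (m + n) x ++ l
replicate-+ zero    n x l = refl
replicate-+ (suc m) n x l = cong (x ∷_) (replicate-+ m n x l)

sorted : ℕ → ℕ → Word → Word
sorted r i W = replicate (r + countR W) R ++ replicate (i + countU W) U

mutual
  -- The counters `r` and `i` absorb the letters of `W` as long as no R follows a U; the first R
  -- that does is handed to `lighter`.
  sorted-or-lighter : ∀ r i W → let V = replicate (suc r) R ++ replicate i U ++ W in
    V ≡ sorted (suc r) i W ⊎ weight V < weight (sorted (suc r) i W)
  sorted-or-lighter r i [] rewrite +-identityʳ r | +-identityʳ i | ++-identityʳ (replicate i U) = inj₁ refl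
  sorted-or-lighter r i (U ∷ W) rewrite replicate-snoc i U W | +-suc i (countU W) =
    sorted-or-lighter r (suc i) W
  sorted-or-lighter r zero (R ∷ W) rewrite replicate-snoc r R W | +-suc r (countR W) =
    sorted-or-lighter (suc r) zero W
  sorted-or-lighter r (suc i) (R ∷ W) = inj₂ (lighter r i 0 W)

  -- `j` grows until the second block of R is complete, so that `weight-swap` applies. This swap
  -- gives the strict increase and joins the blocks; by induction on the rest, later swaps do not
  -- lower the weight.
  lighter : ∀ r i j W →
    weight (replicate (suc r) R ++ replicate (suc i) U ++ replicate (suc j) R ++ W)
    < weight (replicate (suc r + (suc j + countR W)) R ++ replicate (suc i + countU W) U)
  lighter r i j [] rewrite +-identityʳ j | +-identityʳ i =
    subst (weight (replicate (suc r) R ++ replicate (suc i) U ++ replicate (suc j) R ++ []) <_)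
      (cong weight (trans (replicate-+ (suc r) (suc j) R _)
        (cong (replicate (suc r + suc j) R ++_) (++-identityʳ _))))
      (weight-swap r i j empty)
  lighter r i j (R ∷ W) rewrite replicate-snoc j R W | +-suc j (countR W) = lighter r i (suc j) W
  lighter r i j (U ∷ W) = <-≤-trans (weight-swap r i j isU) (≤-trans (≤-reflexive merge) bound)
    where
    merge : weight (replicate (suc r) R ++ replicate (suc j) R ++ replicate (suc i) U ++ U ∷ W)
            ≡ weight (replicate (suc r + suc j) R ++ replicate (suc (suc i)) U ++ W)
    merge = cong weight (trans (replicate-+ (suc r) (suc j) R _)
      (cong (replicate (suc r + suc j) R ++_) (replicate-snoc (suc i) U W)))
    bound : weight (replicate (suc r + suc j) R ++ replicate (suc (suc i)) U ++ W)
            ≤ weight (replicate (suc r + (suc j + countR W)) R ++ replicate (suc i + suc (countU W)) U)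
    bound rewrite sym (+-assoc r (suc j) (countR W)) | +-suc i (countU W)
      with sorted-or-lighter (r + suc j) (suc (suc i)) W
    ... | inj₁ eq = ≤-reflexive (cong weight eq)
    ... | inj₂ lt = <⇒≤ lt

-- Paths of D(a, b) and their numerators

countR-++ : ∀ V W → countR (V ++ W) ≡ countR V + countR W
countR-++ []      W = refl
countR-++ (R ∷ V) W = cong suc (countR-++ V W)
countR-++ (U ∷ V) W = countR-++ V W

countU-++ : ∀ V W → countU (V ++ W) ≡ countU V + countU W
countU-++ []      W = refl
countU-++ (R ∷ V) W = countU-++ V W
countU-++ (U ∷ V) W = cong suc (countU-++ V W)

inits-prefix : ∀ {A : Set} {P : List A → Set} V {W} → All P (inits (V ++ W)) → P V
inits-prefix []      (p ∷ _)  = p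
inits-prefix (x ∷ V) (_ ∷ ps) = inits-prefix V (map⁻ ps)

countR-RsUs : ∀ i j → countR (replicate i R ++ replicate j U) ≡ i
countR-RsUs zero    zero    = refl
countR-RsUs zero    (suc j) = countR-RsUs zero j
countR-RsUs (suc i) j       = cong suc (countR-RsUs i j)

countU-RsUs : ∀ i j → countU (replicate i R ++ replicate j U) ≡ j
countU-RsUs zero    zero    = refl
countU-RsUs zero    (suc j) = cong suc (countU-RsUs zero j)
countU-RsUs (suc i) j       = countU-RsUs i j

module _ (a b : ℕ) where

  private
    Below : ℕ → ℕ → Word → Set
    Below x y u = a * (y + countU u) ≤ b * (x + countR u)

    -- On a vertical run the last point is the highest, so its inequality implies the others.
    below-Us : ∀ j x y → a * (y + j) ≤ b * x → All (Below x y) (inits (replicate j U))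
    below-Us j x y h = subst₂ (λ m n → a * m ≤ b * n) (sym (+-identityʳ y)) (sym (+-identityʳ x))
        (≤-trans (*-monoʳ-≤ a (m≤m+n y j)) h) ∷ rest j h
      where
      rest : ∀ j → a * (y + j) ≤ b * x → All (Below x y) (drop 1 (inits (replicate j U)))
      rest zero    h = []
      rest (suc j) h = map⁺ (All.map (λ {u} → subst (λ m → a * m ≤ b * (x + countR u)) (sym (+-suc y (countU u))))
        (below-Us j x (suc y) (subst (λ m → a * m ≤ b * x) (+-suc y j) h)))

    below-RsUs : ∀ i x j → a * j ≤ b * (x + i) → All (Below x 0) (inits (replicate i R ++ replicate j U))
    below-RsUs zero    x j h = below-Us j x 0 (subst (λ m → a * j ≤ b * m) (+-identityʳ x) h)
    below-RsUs (suc i) x j h = subst (_≤ b * (x + 0)) (sym (*-zeroʳ a)) z≤n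
      ∷ map⁺ (All.map (λ {u} → subst (λ m → a * countU u ≤ b * m) (sym (+-suc x (countR u))))
        (below-RsUs i (suc x) j (subst (λ m → a * j ≤ b * m) (+-suc x i) h)))

  omegaAB-InD : InD a b (omegaAB a b)
  omegaAB-InD = countR-RsUs a b , countU-RsUs a b , below-RsUs a 0 b (≤-reflexive (*-comm a b))

-- Apart from words that are too short, each excluded shape visits a point above the diagonal: (0,
-- 1), or (1, 1) as b < a, or (a - 1, b) if the last step goes right.
InD-shape : ∀ {a b w} → 0 < b → b < a → InD a b w → ∃ λ V → w ≡ R ∷ R ∷ V ++ [ U ]
InD-shape {w = w} 0<b b<a (r≡a , u≡b , below) with initLast w
InD-shape 0<b b<a (refl , u≡b , below) | [] = contradiction b<a λ ()
InD-shape 0<b b<a (refl , refl , below) | V ∷ʳ′ R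
  rewrite countR-++ V [ R ] | countU-++ V [ R ] | +-identityʳ (countU V) | +-comm (countR V) 1 =
  contradiction (inits-prefix V below)
    (<⇒≱ (subst (_< suc (countR V) * countU V) (*-comm (countR V) (countU V)) (m<n+m (countR V * countU V) 0<b)))
InD-shape 0<b b<a (refl , refl , below) | [] ∷ʳ′ U = contradiction b<a λ ()
InD-shape {a} {b} 0<b b<a (refl , refl , below) | (U ∷ V) ∷ʳ′ U =
  contradiction (subst₂ _≤_ (*-identityʳ _) (*-zeroʳ b) (inits-prefix [ U ] below)) (<⇒≱ (≤-<-trans z≤n b<a))
InD-shape 0<b b<a (refl , u≡b , below) | (R ∷ []) ∷ʳ′ U = contradiction 0<b (<⇒≱ b<a)
InD-shape 0<b b<a (refl , refl , below) | (R ∷ U ∷ V) ∷ʳ′ U =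
  contradiction (subst₂ _≤_ (*-identityʳ _) (*-identityʳ _) (inits-prefix (R ∷ U ∷ []) below)) (<⇒≱ b<a)
InD-shape 0<b b<a _ | (R ∷ R ∷ V) ∷ʳ′ U = V , refl

omegaAB-snoc : ∀ a b → omegaAB (suc a) (suc b) ≡ R ∷ (replicate a R ++ replicate b U) ++ [ U ]
omegaAB-snoc a b = cong (R ∷_) (trans (cong (replicate a R ++_) (snoc b)) (sym (++-assoc (replicate a R) _ _)))
  where
  snoc : ∀ b → replicate (suc b) U ≡ replicate b U ++ [ U ]
  snoc zero    = refl
  snoc (suc b) = cong (U ∷_) (snoc b)

M-lt : ∀ {a b w} → 0 < b → b < a → InD a b w → w ≢ omegaAB a b → M w < M (omegaAB a b)
M-lt {a} {b} {w} 0<b b<a D w≢ω with InD-shape 0<b b<a D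
M-lt 0<b b<a (refl , refl , _) w≢ω | V , refl
  rewrite countR-++ V [ U ] | countU-++ V [ U ] | +-identityʳ (countR V) | +-comm (countU V) 1
  -- The outer letters R and U do not enter the weight; the second R is the nonempty first block
  -- that the swaps need.
  with sorted-or-lighter 0 0 V
... | inj₁ eq = contradiction (trans (cong (λ W → R ∷ W ++ [ U ]) eq) (sym (omegaAB-snoc (suc (countR V)) (countU V)))) w≢ω
... | inj₂ lt = subst₂ _<_ (sym (M-weight R (R ∷ V) U))
  (trans (sym (M-weight R (sorted 1 0 V) U)) (cong M (sym (omegaAB-snoc (suc (countR V)) (countU V))))) lt

-- Run lengths

opp : Step → Step
opp R = U
opp U = R

-- Runs ℓ s j W: in sʲW every maximal run of a letter t has length at most ℓ t.
data Runs (ℓ : Step → ℕ) (s : Step) (j : ℕ) : Word → Set where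
  end  : j ≤ ℓ s → Runs ℓ s j []
  same : ∀ {W} → Runs ℓ s (suc j) W → Runs ℓ s j (s ∷ W)
  turn : ∀ {W} → j ≤ ℓ s → Runs ℓ (opp s) 1 W → Runs ℓ s j (opp s ∷ W)

-- The word s ∷ W ends with t; the first letter is kept apart as in `Runs`.
data Ends (t : Step) : Step → Word → Set where
  here  : Ends t t []
  there : ∀ {s s' W} → Ends t s' W → Ends t s (s' ∷ W)

ends-snoc : ∀ {t} s V → Ends t s (V ++ [ t ])
ends-snoc s []       = there here
ends-snoc s (s' ∷ V) = there (ends-snoc s' V)

-- No run crosses the seam, since the left word ends with U and the right one begins with R.
runs-++ : ∀ {ℓ s j W V} → Runs ℓ s j W → Ends U s W → Runs ℓ R 1 V → Runs ℓ s j (W ++ R ∷ V)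
runs-++ (end j≤ℓ)    here      r' = turn j≤ℓ r'
runs-++ (same r)     (there e) r' = same (runs-++ r e r')
runs-++ (turn j≤ℓ r) (there e) r' = turn j≤ℓ (runs-++ r e r')

runs-bound : ∀ {ℓ s j W} → Runs ℓ s j W → j ≤ ℓ s
runs-bound (end j≤ℓ)    = j≤ℓ
runs-bound (same r)     = <⇒≤ (runs-bound r)
runs-bound (turn j≤ℓ _) = j≤ℓ

runs-U-pos : ∀ {ℓ j W} → Runs ℓ R j W → Ends U R W → 0 < ℓ U
runs-U-pos (end _)    ()
runs-U-pos (same r)   (there e) = runs-U-pos r e
runs-U-pos (turn _ r) (there e) = runs-bound r

bounds : ℕ → ℕ → Step → ℕ
bounds a b R = a
bounds a b U = b

ends-U⇒countU : ∀ {W} → Ends U R W → 0 < countU W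
ends-U⇒countU {R ∷ W} (there e) = ends-U⇒countU e
ends-U⇒countU {U ∷ W} _         = s≤s z≤n

no-R⇒replicate : ∀ W → countR W ≡ 0 → W ≡ replicate (countU W) U
no-R⇒replicate []      _ = refl
no-R⇒replicate (U ∷ W) h = cong (U ∷_) (no-R⇒replicate W h)

module _ (a b : ℕ) where

  private
    ℓ : Step → ℕ
    ℓ = bounds a b

  mutual
    runs-after-R : ∀ W {j} → j + countR W ≤ a → countU W ≤ b → Runs ℓ R j W
    runs-after-R []      h k = end (m+n≤o⇒m≤o _ h)
    runs-after-R (R ∷ W) h k = same (runs-after-R W (subst (_≤ a) (+-suc _ _) h) k)
    runs-after-R (U ∷ W) h k = turn (m+n≤o⇒m≤o _ h) (runs-after-U W k (m+n≤o⇒n≤o _ h))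

    runs-after-U : ∀ W {j} → j + countU W ≤ b → countR W ≤ a → Runs ℓ U j W
    runs-after-U []      h k = end (m+n≤o⇒m≤o _ h)
    runs-after-U (U ∷ W) h k = same (runs-after-U W (subst (_≤ b) (+-suc _ _) h) k)
    runs-after-U (R ∷ W) h k = turn (m+n≤o⇒m≤o _ h) (runs-after-R W k (m+n≤o⇒n≤o _ h))

  -- An R still follows and the word ends with U, so the first run of U misses at least one of the
  -- at most b + 1 letters U. For the remaining runs the letter counts suffice.
  runs-first-U : ∀ W {j} → Ends U U W → 0 < j → j + countU W ≤ suc b → 0 < countR W → countR W ≤ a →
    Runs ℓ U j W
  runs-first-U (U ∷ W) (there e) 0<j h r k =
    same (runs-first-U W e (s≤s z≤n) (subst (_≤ suc b) (+-suc _ _) h) r k)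
  runs-first-U (R ∷ W) {suc j} (there e) 0<j (s≤s h) r k =
    turn (≤-trans (≤-reflexive (+-comm 1 j)) (≤-trans (+-monoʳ-≤ j (ends-U⇒countU e)) h)) (runs-after-R W k (m+n≤o⇒n≤o _ h))

  -- If the first run held all a + 1 letters R, only letters U would follow and the word would be
  -- the excluded one. Otherwise an R is left for later, so neither part has more than a of them.
  runs-first-R : ∀ W {j} → Ends U R W → 0 < j → j + countR W ≡ suc a → countU W ≡ suc b →
    replicate j R ++ W ≢ omegaAB (suc a) (suc b) → Runs ℓ R j W
  runs-first-R (R ∷ W) (there e) 0<j h k ne =
    same (runs-first-R W e (s≤s z≤n) (trans (sym (+-suc _ _)) h) k (ne ∘ trans (replicate-snoc _ R W)))
  runs-first-R (U ∷ W) {suc j} (there e) 0<j h k ne with countR W in eq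
  ... | zero  = contradiction
    (cong₂ (λ m V → replicate m R ++ V) (trans (sym (+-identityʳ _)) h)
      (trans (cong (U ∷_) (no-R⇒replicate W eq)) (cong (λ n → replicate n U) k))) ne
  ... | suc r = turn (≤-trans (≤-reflexive (+-comm 1 j)) (≤-trans (+-monoʳ-≤ j (s≤s z≤n)) r≤a))
    (runs-first-U W e (s≤s z≤n) (≤-reflexive k) (subst (0 <_) (sym eq) (s≤s z≤n))
      (subst (_≤ a) (sym eq) (m+n≤o⇒n≤o j r≤a)))
    where
    r≤a : j + suc r ≤ a
    r≤a = ≤-reflexive (suc-injective h)

-- Continued fractions

infix 4 _≼_ _≺_
_≼_ _≺_ : Fraction → Fraction → Set
(n , d) ≼ (n' , d') = n * d' ≤ n' * d
(n , d) ≺ (n' , d') = n * d' < n' * d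

≼-trans : ∀ {x y z} → 0 < proj₂ y → x ≼ y → y ≼ z → x ≼ z
≼-trans {n₁ , d₁} {n₂ , suc d₂} {n₃ , d₃} _ h k = *-cancelʳ-≤ (n₁ * d₃) (n₃ * d₁) (suc d₂) (begin
  n₁ * d₃ * suc d₂   ≡⟨ e n₁ d₃ (suc d₂) ⟩
  n₁ * suc d₂ * d₃   ≤⟨ *-monoˡ-≤ d₃ h ⟩
  n₂ * d₁ * d₃       ≡⟨ e n₂ d₁ d₃ ⟩
  n₂ * d₃ * d₁       ≤⟨ *-monoˡ-≤ d₁ k ⟩
  n₃ * suc d₂ * d₁   ≡⟨ e n₃ (suc d₂) d₁ ⟩
  n₃ * d₁ * suc d₂   ∎)
  where
  open ≤-Reasoning
  e : ∀ x y z → x * y * z ≡ x * z * y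
  e = solveℕ-∀

private
  expand : ∀ c n d n' d' → d' * (c * d + n) ≡ c * (d * d') + n * d'
  expand = solveℕ-∀
  expand' : ∀ c n d n' d' → c * (d * d') + n' * d ≡ d * (c * d' + n')
  expand' = solveℕ-∀

cstep-anti : ∀ c {x y} → x ≼ y → cstep c y ≼ cstep c x
cstep-anti c {n , d} {n' , d'} h = subst₂ _≤_ (sym (expand c n d n' d')) (expand' c n d n' d')
  (+-monoʳ-≤ (c * (d * d')) h)

cstep-anti-≺ : ∀ c {x y} → x ≺ y → cstep c y ≺ cstep c x
cstep-anti-≺ c {n , d} {n' , d'} h = subst₂ _<_ (sym (expand c n d n' d')) (expand' c n d n' d')
  (+-monoʳ-< (c * (d * d')) h)

-- The effect of two equal neighbouring letters, which contribute the entries 1, 1.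
T : Fraction → Fraction
T x = cstep 1 (cstep 1 x)

T^ : ℕ → Fraction → Fraction
T^ zero    x = x
T^ (suc j) x = T (T^ j x)

T^-T : ∀ j x → T^ j (T x) ≡ T^ (suc j) x
T^-T zero    x = refl
T^-T (suc j) x = cong T (T^-T j x)

T^-mono : ∀ j {x y} → x ≼ y → T^ j x ≼ T^ j y
T^-mono zero    h = h
T^-mono (suc j) {x} {y} h =
  cstep-anti 1 {cstep 1 (T^ j y)} {cstep 1 (T^ j x)} (cstep-anti 1 {T^ j x} {T^ j y} (T^-mono j {x} {y} h))

T^-mono-≺ : ∀ j {x y} → x ≺ y → T^ j x ≺ T^ j y
T^-mono-≺ zero    h = h
T^-mono-≺ (suc j) {x} {y} h =
  cstep-anti-≺ 1 {cstep 1 (T^ j y)} {cstep 1 (T^ j x)} (cstep-anti-≺ 1 {T^ j x} {T^ j y} (T^-mono-≺ j {x} {y} h))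

T^-den : ∀ j x → 0 < proj₂ x → 0 < proj₂ (T^ j x)
T^-den zero    x h = h
T^-den (suc j) x h = ≤-trans (T^-den j x h) (m≤n+m _ (1 * proj₂ (cstep 1 (T^ j x))))

-- The fractions 0/1, 1/2, 3/5, 8/13, ..., that is F(2j) / F(2j + 1) in Fibonacci numbers.
T^0 : ℕ → Fraction
T^0 j = T^ j (0 , 1)

T^0-den : ∀ j → 0 < proj₂ (T^0 j)
T^0-den j = T^-den j (0 , 1) (s≤s z≤n)

T^0-mono : ∀ {j k} → j ≤ k → T^0 j ≼ T^0 k
T^0-mono z≤n = z≤n
T^0-mono (s≤s {j} {k} h) =
  cstep-anti 1 {cstep 1 (T^0 k)} {cstep 1 (T^0 j)} (cstep-anti 1 {T^0 j} {T^0 k} (T^0-mono h))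

cstep2≼half : ∀ x → cstep 2 x ≼ T^0 1
cstep2≼half (n , d) = ≤-trans (m≤m+n (d * 2) n) (≤-reflexive (e n d))
  where
  e : ∀ n d → d * 2 + n ≡ 1 * (2 * d + n)
  e = solveℕ-∀

-- Bounds for the continued fraction tails along a word

sameStep-same : ∀ s → sameStep s s ≡ 1 ∷ 1 ∷ []
sameStep-same R = refl
sameStep-same U = refl

sameStep-opp : ∀ s → sameStep s (opp s) ≡ 2 ∷ []
sameStep-opp R = refl
sameStep-opp U = refl

fEntries-same : ∀ s W → fEntries (s ∷ s ∷ W) ≡ 1 ∷ 1 ∷ fEntries (s ∷ W)
fEntries-same s W = cong (_++ fEntries (s ∷ W)) (sameStep-same s)

fEntries-opp : ∀ s W → fEntries (s ∷ opp s ∷ W) ≡ 2 ∷ fEntries (opp s ∷ W)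
fEntries-opp s W = cong (_++ fEntries (opp s ∷ W)) (sameStep-opp s)

-- `T^ j` stands for the part of the current run already read. If the run has j + 1 letters in all,
-- what follows is 0 or [0; 2, ...], hence at most 1/2 = T 0, and the whole is at most T^(j + 1) 0.
fr-runs : ∀ {ℓ s j W} → Runs ℓ s (suc j) W → T^ j (fr (fEntries (s ∷ W))) ≼ T^0 (ℓ s)
fr-runs {j = j} (end j<ℓ) = T^0-mono (<⇒≤ j<ℓ)
fr-runs {ℓ} {s} {j} (same {W} r) rewrite fEntries-same s W =
  subst (_≼ T^0 (ℓ s)) (sym (T^-T j (fr (fEntries (s ∷ W))))) (fr-runs r)
fr-runs {ℓ} {s} {j} (turn {W} j<ℓ r) rewrite fEntries-opp s W =
  ≼-trans {T^ j x} {T^0 (suc j)} {T^0 (ℓ s)} (T^0-den (suc j))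
    (subst (T^ j x ≼_) (T^-T j (0 , 1)) (T^-mono j {x} {T^0 1} (cstep2≼half (fr (fEntries (opp s ∷ W))))))
    (T^0-mono j<ℓ)
  where
  x : Fraction
  x = cstep 2 (fr (fEntries (opp s ∷ W)))

fr-fEntries≤1 : ∀ W → num (fEntries W) ≤ den (fEntries W)
fr-fEntries≤1 []          = z≤n
fr-fEntries≤1 (_ ∷ [])    = z≤n
fr-fEntries≤1 (R ∷ R ∷ W) = ≤-trans (m≤m+n _ 0) (m≤m+n _ _)
fr-fEntries≤1 (R ∷ U ∷ W) = ≤-trans (m≤m+n _ _) (m≤m+n _ _)
fr-fEntries≤1 (U ∷ R ∷ W) = ≤-trans (m≤m+n _ _) (m≤m+n _ _)
fr-fEntries≤1 (U ∷ U ∷ W) = ≤-trans (m≤m+n _ 0) (m≤m+n _ _)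

twoPlus : Fraction → Fraction → Fraction
twoPlus (n , d) (n' , d') = 2 * (d * d') + n * d' + n' * d , d * d'

twoPlus-comm : ∀ x y → twoPlus x y ≡ twoPlus y x
twoPlus-comm (n , d) (n' , d') = cong₂ _,_ (e n d n' d') (*-comm d d')
  where
  e : ∀ n d n' d' → 2 * (d * d') + n * d' + n' * d ≡ 2 * (d' * d) + n' * d + n * d'
  e = solveℕ-∀

-- If l follows the entry c, and q' / q is the ratio of the denominators before c, then the convergent
-- p / q of α satisfies q |q α - p| = (c + q' / q + [0; l])⁻¹; Bounded says that this is at least n / m.
Bounded : Fraction → Fraction → ℕ → List ℕ → Set
Bounded (m , n) (q' , q) c l = n * (den l * (c * q + q') + num l * q) ≤ m * (q * den l)

-- The index is the ratio q' / q of consecutive denominators; reading the entry c turns it into q /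
-- (c q + q'), which is `cstep c` of it.
data Admissible (B : Fraction) : Fraction → List ℕ → Set where
  []  : ∀ {x} → Admissible B x []
  _∷_ : ∀ {x c l} → Bounded B x c l → Admissible B (cstep c x) l → Admissible B x (c ∷ l)

bounded-1 : ∀ {B q' q} l → 3 * proj₂ B ≤ proj₁ B → q' ≤ q → num l ≤ den l → Bounded B (q' , q) 1 l
bounded-1 {m , n} {q'} {q} l 3n≤m q'≤q k = begin
  n * (den l * (1 * q + q') + num l * q)
    ≤⟨ *-monoʳ-≤ n (+-mono-≤ (*-monoʳ-≤ (den l) (+-monoʳ-≤ (1 * q) q'≤q)) (*-monoˡ-≤ q k)) ⟩
  n * (den l * (1 * q + q) + den l * q) ≡⟨ e n (den l) q ⟩
  3 * n * (q * den l)                   ≤⟨ *-monoˡ-≤ (q * den l) 3n≤m ⟩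
  m * (q * den l)                       ∎
  where
  open ≤-Reasoning
  e : ∀ n d q → n * (d * (1 * q + q) + d * q) ≡ 3 * n * (q * d)
  e = solveℕ-∀

bounded-2 : ∀ {x y z} l → z ≼ x → fr l ≼ y → Bounded (twoPlus x y) z 2 l
bounded-2 {n , d} {n' , d'} {q' , q} l h k = begin
  d * d' * (e * (2 * q + q') + f * q)
    ≡⟨ e₁ d d' e q q' f ⟩
  2 * (d * d') * (q * e) + d' * e * (q' * d) + d * q * (f * d')
    ≤⟨ +-mono-≤ (+-monoʳ-≤ (2 * (d * d') * (q * e)) (*-monoʳ-≤ (d' * e) h)) (*-monoʳ-≤ (d * q) k) ⟩
  2 * (d * d') * (q * e) + d' * e * (n * q) + d * q * (n' * e)
    ≡⟨ e₂ d d' e q n n' ⟩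
  (2 * (d * d') + n * d' + n' * d) * (q * e) ∎
  where
  open ≤-Reasoning
  e f : ℕ
  e = den l
  f = num l
  e₁ : ∀ d d' e q q' f → d * d' * (e * (2 * q + q') + f * q)
     ≡ 2 * (d * d') * (q * e) + d' * e * (q' * d) + d * q * (f * d')
  e₁ = solveℕ-∀
  e₂ : ∀ d d' e q n n' → 2 * (d * d') * (q * e) + d' * e * (n * q) + d * q * (n' * e)
     ≡ (2 * (d * d') + n * d' + n' * d) * (q * e)
  e₂ = solveℕ-∀

-- `T^0 1` is 1/2. Hence the bound for the entries 2 also covers the entries 1, where 3 is enough.
twoPlus≥3 : ∀ {x y} → T^0 1 ≼ x → T^0 1 ≼ y → 3 * proj₂ (twoPlus x y) ≤ proj₁ (twoPlus x y)
twoPlus≥3 {n , d} {n' , d'} h k = *-cancelˡ-≤ 2 (begin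
  2 * (3 * (d * d'))                                ≡⟨ e₁ d d' ⟩
  4 * (d * d') + d' * (1 * d) + d * (1 * d')        ≤⟨ +-mono-≤ (+-monoʳ-≤ (4 * (d * d')) (*-monoʳ-≤ d' h)) (*-monoʳ-≤ d k) ⟩
  4 * (d * d') + d' * (n * 2) + d * (n' * 2)        ≡⟨ e₂ d d' n n' ⟩
  2 * (2 * (d * d') + n * d' + n' * d)              ∎)
  where
  open ≤-Reasoning
  e₁ : ∀ d d' → 2 * (3 * (d * d')) ≡ 4 * (d * d') + d' * (1 * d) + d * (1 * d')
  e₁ = solveℕ-∀
  e₂ : ∀ d d' n n' → 4 * (d * d') + d' * (n * 2) + d * (n' * 2) ≡ 2 * (2 * (d * d') + n * d' + n' * d)
  e₂ = solveℕ-∀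

lagrangeBound : (Step → ℕ) → Fraction
lagrangeBound ℓ = twoPlus (T^0 (ℓ R)) (T^0 (ℓ U))

module _ (ℓ : Step → ℕ) (ℓR : 0 < ℓ R) (ℓU : 0 < ℓ U) where

  lagrangeBound≥3 : 3 * proj₂ (lagrangeBound ℓ) ≤ proj₁ (lagrangeBound ℓ)
  lagrangeBound≥3 = twoPlus≥3 {T^0 (ℓ R)} {T^0 (ℓ U)} (T^0-mono ℓR) (T^0-mono ℓU)

  bounded-turn : ∀ s {x} l → x ≼ T^0 (ℓ s) → fr l ≼ T^0 (ℓ (opp s)) → Bounded (lagrangeBound ℓ) x 2 l
  bounded-turn R {x} l h k = bounded-2 {T^0 (ℓ R)} {T^0 (ℓ U)} {x} l h k
  bounded-turn U {x} l h k =
    subst (λ B → Bounded B x 2 l) (twoPlus-comm (T^0 (ℓ U)) (T^0 (ℓ R))) (bounded-2 {T^0 (ℓ U)} {T^0 (ℓ R)} {x} l h k)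

  -- The tail looking back over the j letters of the current run is at most T^j 0: an equal letter
  -- applies T, and a turn resets it to at most 1/2 = T 0. The tail looking ahead is bounded by
  -- `fr-runs`.
  admissible-runs : ∀ {s j W x} → Runs ℓ s j W → proj₁ x ≤ proj₂ x → x ≼ T^0 j →
    Admissible (lagrangeBound ℓ) x (fEntries (s ∷ W))
  admissible-runs (end _) _ _ = []
  admissible-runs {s} {j} {_} {x@(q' , q)} (same {W} r) q'≤q h rewrite fEntries-same s W =
    (bounded-1 {lagrangeBound ℓ} (1 ∷ fEntries (s ∷ W)) lagrangeBound≥3 q'≤q
        (≤-trans (m≤m+n (den (fEntries (s ∷ W))) 0) (m≤m+n _ _)))
    ∷ (bounded-1 {lagrangeBound ℓ} (fEntries (s ∷ W)) lagrangeBound≥3 q≤ (fr-fEntries≤1 (s ∷ W)))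
    ∷ admissible-runs r (≤-trans (m≤m+n _ 0) (m≤m+n _ _)) (T^-mono 1 {x} {T^0 j} h)
    where
    q≤ : q ≤ 1 * q + q'
    q≤ = ≤-trans (m≤m+n q 0) (m≤m+n _ _)
  admissible-runs {s} {j} {_} {x} (turn {W} j≤ℓ r) q'≤q h rewrite fEntries-opp s W =
    (bounded-turn s {x} (fEntries (opp s ∷ W))
      (≼-trans {x} {T^0 j} {T^0 (ℓ s)} (T^0-den j) h (T^0-mono j≤ℓ)) (fr-runs r))
    ∷ admissible-runs r (≤-trans (m≤m+n _ _) (m≤m+n _ _)) (cstep2≼half x)

-- Legendre's argument

pos-lin : ∀ a b c d → + a ℤ.* + b ℤ.+ + c ℤ.* + d ≡ + (a * b + c * d)
pos-lin a b c d = trans (cong₂ ℤ._+_ (sym (ℤ.pos-* a b)) (sym (ℤ.pos-* c d))) (sym (ℤ.pos-+ (a * b) (c * d)))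

-- B = 0 would leave a r, which is never strictly between 0 and r, and B < 0 < a would give a r - B
-- q ≥ r. So B is nonzero and the summands d B and n a do not cancel.
coefficients⁺ : ∀ d n q r a B → 0 < ∣ + a ℤ.* + r ℤ.- B ℤ.* + q ∣ → ∣ + a ℤ.* + r ℤ.- B ℤ.* + q ∣ < r →
  d ≤ ∣ + d ℤ.* B ℤ.+ + n ℤ.* + a ∣
coefficients⁺ d n q r zero (+ zero) h _ = contradiction h λ ()
coefficients⁺ d n q r (suc a) (+ zero) _ h = contradiction h
  (≤⇒≯ (≤-trans (m≤m+n r (a * r)) (≤-reflexive (sym (trans (cong ∣_∣ (e (+ suc a) (+ r))) (ℤ.abs-* (+ suc a) (+ r)))))))
  where
  e : ∀ x y → x ℤ.* y ℤ.- + 0 ≡ x ℤ.* y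
  e = solveℤ-∀
coefficients⁺ d n q r a (+ suc b) _ _ rewrite pos-lin d (suc b) n a =
  ≤-trans (m≤m*n d (suc b)) (m≤m+n _ _)
coefficients⁺ d n q r zero -[1+ b ] _ _ = ≤-trans (m≤m*n d (suc b)) (≤-reflexive (sym e))
  where
  e₁ : ∀ d n b → d ℤ.* (ℤ.- b) ℤ.+ n ℤ.* + 0 ≡ ℤ.- (d ℤ.* b)
  e₁ = solveℤ-∀
  e : ∣ + d ℤ.* -[1+ b ] ℤ.+ + n ℤ.* + 0 ∣ ≡ d * suc b
  e = trans (cong ∣_∣ (e₁ (+ d) (+ n) (+ suc b)))
    (trans (ℤ.∣-i∣≡∣i∣ (+ d ℤ.* + suc b)) (ℤ.abs-* (+ d) (+ suc b)))
coefficients⁺ d n q r (suc a) -[1+ b ] _ h = contradiction h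
  (≤⇒≯ (≤-trans (m≤m+n r (a * r)) (≤-trans (m≤m+n _ (suc b * q)) (≤-reflexive (sym e)))))
  where
  e₁ : ∀ a r b q → a ℤ.* r ℤ.- (ℤ.- b) ℤ.* q ≡ a ℤ.* r ℤ.+ b ℤ.* q
  e₁ = solveℤ-∀
  e : ∣ + suc a ℤ.* + r ℤ.- -[1+ b ] ℤ.* + q ∣ ≡ suc a * r + suc b * q
  e = cong ∣_∣ (trans (e₁ (+ suc a) (+ r) (+ suc b) (+ q)) (pos-lin (suc a) r (suc b) q))

coefficients : ∀ d n q r A B → 0 < ∣ A ℤ.* + r ℤ.- B ℤ.* + q ∣ → ∣ A ℤ.* + r ℤ.- B ℤ.* + q ∣ < r →
  d ≤ ∣ + d ℤ.* B ℤ.+ + n ℤ.* A ∣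
coefficients d n q r (+ a) B h k = coefficients⁺ d n q r a B h k
coefficients d n q r -[1+ a ] B h k =
  subst (d ≤_) (neg-abs (e₂ (+ d) B (+ n) (+ suc a)))
    (coefficients⁺ d n q r (suc a) (ℤ.- B) (subst (0 <_) eq h) (subst (_< r) eq k))
  where
  e₁ : ∀ a r B q → (ℤ.- a) ℤ.* r ℤ.- B ℤ.* q ≡ ℤ.- (a ℤ.* r ℤ.- (ℤ.- B) ℤ.* q)
  e₁ = solveℤ-∀
  e₂ : ∀ d B n a → d ℤ.* (ℤ.- B) ℤ.+ n ℤ.* a ≡ ℤ.- (d ℤ.* B ℤ.+ n ℤ.* (ℤ.- a))
  e₂ = solveℤ-∀
  neg-abs : ∀ {i j} → i ≡ ℤ.- j → ∣ i ∣ ≡ ∣ j ∣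
  neg-abs {j = j} refl = ℤ.∣-i∣≡∣i∣ j
  eq = neg-abs (e₁ (+ suc a) (+ r) B (+ q))

State : Set
State = (ℕ × ℕ) × (ℕ × ℕ)

step : ℕ → State → State
step c ((p' , q') , (p , q)) = (p , q) , (c * p + p' , c * q + q')

ratio : State → Fraction
ratio ((p' , q') , (p , q)) = q' , q

det : State → ℤ
det ((p' , q') , (p , q)) = + p' ℤ.* + q ℤ.- + p ℤ.* + q'

-- The convergent P / Q reached from the state by reading `l`, in the linear form of `numerAux-fr`.
finalP finalQ : List ℕ → State → ℕ
finalP l ((p' , q') , (p , q)) = den l * p + num l * p'
finalQ l ((p' , q') , (p , q)) = den l * q + num l * q'

pos-step : ∀ c p p' → + (c * p + p') ≡ + c ℤ.* + p ℤ.+ + p'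
pos-step c p p' = trans (ℤ.pos-+ (c * p) p') (cong (ℤ._+ + p') (ℤ.pos-* c p))

det-step : ∀ c s → det (step c s) ≡ ℤ.- det s
det-step c ((p' , q') , (p , q)) =
  trans (cong₂ (λ t r → + p ℤ.* r ℤ.- t ℤ.* + q) (pos-step c p p') (pos-step c q q')) (e (+ c) (+ p) (+ p') (+ q) (+ q'))
  where
  e : ∀ c p p' q q' → p ℤ.* (c ℤ.* q ℤ.+ q') ℤ.- (c ℤ.* p ℤ.+ p') ℤ.* q ≡ ℤ.- (p' ℤ.* q ℤ.- p ℤ.* q')
  e = solveℤ-∀

private
  shift : ∀ c d n p p' → (c * d + n) * p + d * p' ≡ d * (c * p + p') + n * p
  shift = solveℕ-∀

finalP-step : ∀ c l s → finalP (c ∷ l) s ≡ finalP l (step c s)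
finalP-step c l ((p' , _) , (p , _)) = shift c (den l) (num l) p p'

finalQ-step : ∀ c l s → finalQ (c ∷ l) s ≡ finalQ l (step c s)
finalQ-step c l ((_ , q') , (_ , q)) = shift c (den l) (num l) q q'

-- The limit is replaced by a later convergent P / Q: this is Y Q |X / Y - P / Q|.
error : List ℕ → State → ℤ → ℕ → ℕ
error l s X Y = ∣ X ℤ.* + finalQ l s ℤ.- + finalP l s ℤ.* + Y ∣

-- Legendre: for Y below the next denominator c q + q', |X Q - P Y| is at least its value den l at p / q.
error-bound : ∀ c l s X Y → ∣ det s ∣ ≡ 1 → 0 < Y → Y < proj₂ (proj₂ (step c s)) →
  den l ≤ error l (step c s) X Y
error-bound c l s@((p' , q') , (p , q)) X Y unit 0<Y Y<r =
  subst (den l ≤_) (cong ∣_∣ goal)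
    (coefficients (den l) (num l) q r A B (subst (0 <_) (sym size) 0<Y) (subst (_< r) (sym size) Y<r))
  where
  r t : ℕ
  r = c * q + q'
  t = c * p + p'
  A B : ℤ
  A = X ℤ.* + q ℤ.- + p ℤ.* + Y
  B = X ℤ.* + r ℤ.- + t ℤ.* + Y
  e₁ : ∀ X Y p q t r → (X ℤ.* q ℤ.- p ℤ.* Y) ℤ.* r ℤ.- (X ℤ.* r ℤ.- t ℤ.* Y) ℤ.* q
       ≡ (ℤ.- (p ℤ.* r ℤ.- t ℤ.* q)) ℤ.* Y
  e₁ = solveℤ-∀
  -- The X terms cancel, and Y is left with the determinant of two consecutive convergents as its
  -- factor.
  size : ∣ A ℤ.* + r ℤ.- B ℤ.* + q ∣ ≡ Y
  size = trans (cong ∣_∣ (trans (e₁ X (+ Y) (+ p) (+ q) (+ t) (+ r))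
           (cong (λ D → (ℤ.- D) ℤ.* + Y) (det-step c s))))
         (trans (ℤ.abs-* (ℤ.- (ℤ.- det s)) (+ Y))
           (trans (cong (_* Y) (trans (ℤ.∣-i∣≡∣i∣ (ℤ.- det s)) (trans (ℤ.∣-i∣≡∣i∣ (det s)) unit))) (*-identityˡ Y)))
  e₂ : ∀ d n X Y p q t r → d ℤ.* (X ℤ.* r ℤ.- t ℤ.* Y) ℤ.+ n ℤ.* (X ℤ.* q ℤ.- p ℤ.* Y)
       ≡ X ℤ.* (d ℤ.* r ℤ.+ n ℤ.* q) ℤ.- (d ℤ.* t ℤ.+ n ℤ.* p) ℤ.* Y
  e₂ = solveℤ-∀
  goal : + den l ℤ.* B ℤ.+ + num l ℤ.* A
         ≡ X ℤ.* + (den l * r + num l * q) ℤ.- + (den l * t + num l * p) ℤ.* + Y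
  goal = trans (e₂ (+ den l) (+ num l) X (+ Y) (+ p) (+ q) (+ t) (+ r))
    (cong₂ (λ Q P → X ℤ.* Q ℤ.- P ℤ.* + Y) (pos-lin (den l) r (num l) q) (pos-lin (den l) t (num l) p))

-- The list is read until q ≤ Y < c q + q'. There `error-bound` gives at least `den l` for the
-- error, and `Bounded` compares q `den l` with Q.
admissible⇒badlyApproximable : ∀ {m n l s} → Admissible (m , n) (ratio s) l → ∣ det s ∣ ≡ 1 →
  ∀ X Y → 0 < Y → proj₂ (proj₂ s) ≤ Y → Y < finalQ l s → n * finalQ l s ≤ m * (Y * error l s X Y)
admissible⇒badlyApproximable {s = s@((_ , q') , (_ , q))} [] _ X Y _ q≤Y Y<Q =
  contradiction (subst (Y <_) (trans (+-identityʳ (1 * q)) (*-identityˡ q)) Y<Q) (≤⇒≯ q≤Y)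
admissible⇒badlyApproximable {m} {n} {c ∷ l} {s@((p' , q') , (p , q))} (bound ∷ adm) unit X Y 0<Y q≤Y Y<Q
  rewrite finalQ-step c l s | finalP-step c l s with <-≤-connex Y (c * q + q')
... | inj₁ Y<r = ≤-trans bound
  (*-monoʳ-≤ m (*-mono-≤ q≤Y (error-bound c l s X Y unit 0<Y Y<r)))
... | inj₂ r≤Y = admissible⇒badlyApproximable {s = step c s} adm
  (trans (cong ∣_∣ (det-step c s)) (trans (ℤ.∣-i∣≡∣i∣ (det s)) unit)) X Y 0<Y r≤Y Y<Q

-- Convergents through finite segments of the entries

seg : (ℕ → ℕ) → ℕ → ℕ → List ℕ
seg c k zero    = []
seg c k (suc n) = c k ∷ seg c (suc k) n

seg-+ : ∀ c k m n → seg c k (m + n) ≡ seg c k m ++ seg c (k + m) n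
seg-+ c k zero    n = cong (λ i → seg c i n) (sym (+-identityʳ k))
seg-+ c k (suc m) n = cong (c k ∷_)
  (trans (seg-+ c (suc k) m n) (cong (λ i → seg c (suc k) m ++ seg c i n) (sym (+-suc k m))))

seg-nth : ∀ c k l → (∀ j → j < length l → c (j + k) ≡ nth l j) → seg c k (length l) ≡ l
seg-nth c k []      h = refl
seg-nth c k (x ∷ l) h = cong₂ _∷_ (h 0 (s≤s z≤n))
  (seg-nth c (suc k) l (λ j j<n → trans (cong c (+-suc j k)) (h (suc j) (s≤s j<n))))

steps : List ℕ → State → State
steps []      s = s
steps (c ∷ l) s = steps l (step c s)

cfPQ-seg : ∀ c k n → cfPQ c (n + k) ≡ steps (seg c (suc k) n) (cfPQ c k)
cfPQ-seg c k zero    = refl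
cfPQ-seg c k (suc n) = trans (cong (cfPQ c) (sym (+-suc n k))) (cfPQ-seg c (suc k) n)

steps-final : ∀ l s → proj₂ (steps l s) ≡ (finalP l s , finalQ l s)
steps-final []      ((_ , _) , (p , q)) = cong₂ _,_ (e p) (e q)
  where
  e : ∀ x → x ≡ 1 * x + 0
  e = solveℕ-∀
steps-final (c ∷ l) s = trans (steps-final l (step c s))
  (cong₂ _,_ (sym (finalP-step c l s)) (sym (finalQ-step c l s)))

conv-final : ∀ c k n → let l = seg c (suc k) n ; s = cfPQ c k in
  (convP c (n + k) ≡ finalP l s) × (convQ c (n + k) ≡ finalQ l s)
conv-final c k n = cong proj₁ e , cong proj₂ e
  where
  e = trans (cong proj₂ (cfPQ-seg c k n)) (steps-final (seg c (suc k) n) (cfPQ c k))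

det-even : ∀ c k → det (cfPQ c (2 * k)) ≡ + 1
det-odd  : ∀ c k → det (cfPQ c (suc (2 * k))) ≡ -[1+ 0 ]
det-even c zero    = cong (λ x → + 1 ℤ.- x) (ℤ.*-zeroʳ (+ c 0))
det-even c (suc k) = trans (cong (det ∘ cfPQ c) (cong suc (+-suc k (k + 0))))
  (trans (det-step (c (suc (suc (2 * k)))) (cfPQ c (suc (2 * k)))) (cong ℤ.-_ (det-odd c k)))
det-odd c k = trans (det-step (c (suc (2 * k))) (cfPQ c (2 * k))) (cong ℤ.-_ (det-even c k))

-- P / Q and p / q differ by `num l` / (q Q), and the sign of the determinant tells which is larger.
final-det : (l : List ℕ) (s : State) → let (p' , q') , (p , q) = s in
  + finalP l s ℤ.* + q ≡ + p ℤ.* + finalQ l s ℤ.+ + num l ℤ.* det s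
final-det l ((p' , q') , (p , q)) =
  trans (cong (ℤ._* + q) (sym (pos-lin (den l) p (num l) p')))
    (trans (e (+ den l) (+ num l) (+ p) (+ p') (+ q) (+ q'))
      (cong (λ Q → + p ℤ.* Q ℤ.+ + num l ℤ.* (+ p' ℤ.* + q ℤ.- + p ℤ.* + q')) (pos-lin (den l) q (num l) q')))
  where
  e : ∀ d n p p' q q' → (d ℤ.* p ℤ.+ n ℤ.* p') ℤ.* q
      ≡ p ℤ.* (d ℤ.* q ℤ.+ n ℤ.* q') ℤ.+ n ℤ.* (p' ℤ.* q ℤ.- p ℤ.* q')
  e = solveℤ-∀

-- Even convergents only grow and odd convergents only decrease from a given one on.
below-final : ∀ {l s A B} → det s ≡ + 1 → 0 < finalQ l s →
  A ℤ.* + proj₂ (proj₂ s) ℤ.< + proj₁ (proj₂ s) ℤ.* + B → A ℤ.* + finalQ l s ℤ.< + finalP l s ℤ.* + B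
below-final {l} {s@(_ , (p , q))} {A} {B} one 0<Q h with finalQ l s | finalP l s | final-det l s
... | zero  | _ | _  = contradiction 0<Q λ ()
... | suc Q | P | fd = ℤ.*-cancelʳ-<-nonNeg (+ q) (begin-strict
  A ℤ.* + suc Q ℤ.* + q               ≡⟨ e A (+ suc Q) (+ q) ⟩
  A ℤ.* + q ℤ.* + suc Q               <⟨ ℤ.*-monoʳ-<-pos (+ suc Q) h ⟩
  + p ℤ.* + B ℤ.* + suc Q             ≡⟨ e (+ p) (+ B) (+ suc Q) ⟩
  + p ℤ.* + suc Q ℤ.* + B             ≤⟨ ℤ.*-monoʳ-≤-nonNeg (+ B) le ⟩
  + P ℤ.* + q ℤ.* + B                 ≡⟨ e (+ P) (+ q) (+ B) ⟩
  + P ℤ.* + B ℤ.* + q                 ∎)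
  where
  open ℤ.≤-Reasoning
  e : ∀ x y z → x ℤ.* y ℤ.* z ≡ x ℤ.* z ℤ.* y
  e = solveℤ-∀
  le : + p ℤ.* + suc Q ℤ.≤ + P ℤ.* + q
  le = subst (+ p ℤ.* + suc Q ℤ.≤_)
    (sym (trans fd (cong (λ x → + p ℤ.* + suc Q ℤ.+ x) (trans (cong (+ num l ℤ.*_) one) (ℤ.*-identityʳ (+ num l))))))
    (ℤ.i≤i+j _ (+ num l))

above-final : ∀ {l s A B} → det s ≡ -[1+ 0 ] → 0 < finalQ l s →
  + proj₁ (proj₂ s) ℤ.* + B ℤ.< A ℤ.* + proj₂ (proj₂ s) → + finalP l s ℤ.* + B ℤ.< A ℤ.* + finalQ l s
above-final {l} {s@(_ , (p , q))} {A} {B} one 0<Q h with finalQ l s | finalP l s | final-det l s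
... | zero  | _ | _  = contradiction 0<Q λ ()
... | suc Q | P | fd = ℤ.*-cancelʳ-<-nonNeg (+ q) (begin-strict
  + P ℤ.* + B ℤ.* + q                 ≡⟨ e (+ P) (+ B) (+ q) ⟩
  + P ℤ.* + q ℤ.* + B                 ≤⟨ ℤ.*-monoʳ-≤-nonNeg (+ B) le ⟩
  + p ℤ.* + suc Q ℤ.* + B             ≡⟨ e (+ p) (+ suc Q) (+ B) ⟩
  + p ℤ.* + B ℤ.* + suc Q             <⟨ ℤ.*-monoʳ-<-pos (+ suc Q) h ⟩
  A ℤ.* + q ℤ.* + suc Q               ≡⟨ e A (+ q) (+ suc Q) ⟩
  A ℤ.* + suc Q ℤ.* + q               ∎)
  where
  open ℤ.≤-Reasoning
  e : ∀ x y z → x ℤ.* y ℤ.* z ≡ x ℤ.* z ℤ.* y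
  e = solveℤ-∀
  e' : ∀ x n → x ℤ.+ n ℤ.* (ℤ.- + 1) ≡ x ℤ.- n
  e' = solveℤ-∀
  le : + P ℤ.* + q ℤ.≤ + p ℤ.* + suc Q
  le = subst (ℤ._≤ + p ℤ.* + suc Q)
    (sym (trans fd (trans (cong (λ D → + p ℤ.* + suc Q ℤ.+ + num l ℤ.* D) one) (e' (+ p ℤ.* + suc Q) (+ num l)))))
    (ℤ.i-j≤i _ (+ num l))

abs-< : ∀ {i k} → i ℤ.< + k → ℤ.- i ℤ.< + k → ∣ i ∣ < k
abs-< {+ _}      (ℤ.+<+ h) _ = h
abs-< { -[1+ _ ]} _ (ℤ.+<+ h) = h

-- The hypotheses place P / Q within n / (m Y²) of X / Y. Cleared of denominators, they bound m Y (X
-- Q - P Y) by n Q from both sides.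
approximation-error : ∀ {l s X} m n Y → let P = finalP l s ; Q = finalQ l s in
  (X ℤ.* + m ℤ.* + Y ℤ.- + n) ℤ.* + Q ℤ.< + P ℤ.* + (m * Y * Y) →
  + P ℤ.* + (m * Y * Y) ℤ.< (X ℤ.* + m ℤ.* + Y ℤ.+ + n) ℤ.* + Q →
  m * (Y * error l s X Y) < n * Q
approximation-error {l} {s} {X} m n Y h k =
  subst (_< n * Q) (trans (ℤ.abs-* (+ (m * Y)) E) (*-assoc m Y ∣ E ∣)) (abs-< {+ (m * Y) ℤ.* E} below above)
  where
  P Q : ℕ
  P = finalP l s
  Q = finalQ l s
  E : ℤ
  E = X ℤ.* + Q ℤ.- + P ℤ.* + Y
  cube : + (m * Y * Y) ≡ + m ℤ.* + Y ℤ.* + Y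
  cube = trans (ℤ.pos-* (m * Y) Y) (cong (ℤ._* + Y) (ℤ.pos-* m Y))
  e₁ : ∀ X m Y n P Q → m ℤ.* Y ℤ.* (X ℤ.* Q ℤ.- P ℤ.* Y)
    ≡ (X ℤ.* m ℤ.* Y ℤ.- n) ℤ.* Q ℤ.+ (n ℤ.* Q ℤ.- P ℤ.* (m ℤ.* Y ℤ.* Y))
  e₁ = solveℤ-∀
  e₂ : ∀ n P Q M → P ℤ.* M ℤ.+ (n ℤ.* Q ℤ.- P ℤ.* M) ≡ n ℤ.* Q
  e₂ = solveℤ-∀
  e₃ : ∀ X m Y n P Q → ℤ.- (m ℤ.* Y ℤ.* (X ℤ.* Q ℤ.- P ℤ.* Y))
    ≡ P ℤ.* (m ℤ.* Y ℤ.* Y) ℤ.+ (n ℤ.* Q ℤ.- (X ℤ.* m ℤ.* Y ℤ.+ n) ℤ.* Q)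
  e₃ = solveℤ-∀
  e₄ : ∀ x y → x ℤ.+ (y ℤ.- x) ≡ y
  e₄ = solveℤ-∀
  below : + (m * Y) ℤ.* E ℤ.< + (n * Q)
  below = subst₂ ℤ._<_
    (sym (trans (cong (ℤ._* E) (ℤ.pos-* m Y)) (e₁ X (+ m) (+ Y) (+ n) (+ P) (+ Q))))
    (trans (e₂ (+ n) (+ P) (+ Q) (+ m ℤ.* + Y ℤ.* + Y)) (sym (ℤ.pos-* n Q)))
    (ℤ.+-monoˡ-< (+ n ℤ.* + Q ℤ.- + P ℤ.* (+ m ℤ.* + Y ℤ.* + Y))
      (subst (λ M → (X ℤ.* + m ℤ.* + Y ℤ.- + n) ℤ.* + Q ℤ.< + P ℤ.* M) cube h))
  above : ℤ.- (+ (m * Y) ℤ.* E) ℤ.< + (n * Q)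
  above = subst₂ ℤ._<_
    (sym (trans (cong (λ x → ℤ.- (x ℤ.* E)) (ℤ.pos-* m Y)) (e₃ X (+ m) (+ Y) (+ n) (+ P) (+ Q))))
    (trans (e₄ ((X ℤ.* + m ℤ.* + Y ℤ.+ + n) ℤ.* + Q) (+ n ℤ.* + Q)) (sym (ℤ.pos-* n Q)))
    (ℤ.+-monoˡ-< (+ n ℤ.* + Q ℤ.- (X ℤ.* + m ℤ.* + Y ℤ.+ + n) ℤ.* + Q)
      (subst (λ M → + P ℤ.* M ℤ.< (X ℤ.* + m ℤ.* + Y ℤ.+ + n) ℤ.* + Q) cube k))

finalQ-growth : ∀ l s → All (1 ≤_) l → 0 < proj₂ (proj₁ s) → 0 < proj₂ (proj₂ s) →
  proj₂ (proj₂ s) + length l ≤ finalQ l s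
finalQ-growth []      s@(_ , (_ , q)) _ _ _ = ≤-reflexive (e q)
  where
  e : ∀ q → q + 0 ≡ 1 * q + 0
  e = solveℕ-∀
finalQ-growth (suc c ∷ l) s@((_ , q') , (_ , q)) (s≤s _ ∷ pos) 0<q' 0<q = begin
  q + suc (length l)          ≡⟨ e q (length l) ⟩
  q + 1 + length l            ≤⟨ +-monoˡ-≤ (length l) (+-mono-≤ (m≤m+n q (c * q)) 0<q') ⟩
  suc c * q + q' + length l   ≤⟨ finalQ-growth l (step (suc c) s) pos 0<q (≤-trans 0<q (≤-trans (m≤m+n q (c * q)) (m≤m+n _ q'))) ⟩
  finalQ l (step (suc c) s)   ≡⟨ sym (finalQ-step (suc c) l s) ⟩
  finalQ (suc c ∷ l) s        ∎
  where
  open ≤-Reasoning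
  e : ∀ q n → q + suc n ≡ q + 1 + n
  e = solveℕ-∀

-- The first step may leave the denominator unchanged, since q' may be 0 at the start; from then on
-- `finalQ-growth` applies.
length≤finalQ : ∀ l s → All (1 ≤_) l → 0 < proj₂ (proj₂ s) → length l ≤ finalQ l s
length≤finalQ []          s _ _ = z≤n
length≤finalQ (suc c ∷ l) s@(_ , (_ , q)) (s≤s _ ∷ pos) 0<q =
  ≤-trans (≤-trans (+-monoˡ-≤ (length l) 0<r) (finalQ-growth l (step (suc c) s) pos 0<q 0<r))
    (≤-reflexive (sym (finalQ-step (suc c) l s)))
  where
  0<r : 0 < proj₂ (proj₂ (step (suc c) s))
  0<r = ≤-trans 0<q (≤-trans (m≤m+n q (c * q)) (m≤m+n _ _))

-- The periodic words

fEntries-pos : ∀ W → All (1 ≤_) (fEntries W)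
fEntries-pos []          = []
fEntries-pos (_ ∷ [])    = []
fEntries-pos (R ∷ R ∷ W) = s≤s z≤n ∷ s≤s z≤n ∷ fEntries-pos (R ∷ W)
fEntries-pos (R ∷ U ∷ W) = s≤s z≤n ∷ fEntries-pos (U ∷ W)
fEntries-pos (U ∷ R ∷ W) = s≤s z≤n ∷ fEntries-pos (R ∷ W)
fEntries-pos (U ∷ U ∷ W) = s≤s z≤n ∷ s≤s z≤n ∷ fEntries-pos (U ∷ W)

fEntries-++ : ∀ {s W} V → Ends U s W → fEntries (s ∷ W ++ R ∷ V) ≡ fEntries (s ∷ W) ++ 2 ∷ fEntries (R ∷ V)
fEntries-++ V here = refl
fEntries-++ V (there {s} {t} {W} e) =
  trans (cong (sameStep s t ++_) (fEntries-++ V e)) (sym (++-assoc (sameStep s t) (fEntries (t ∷ W)) _))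

-- R ∷ powers N ρ is the (N + 1)-st power of R ∷ ρ.
powers : ℕ → Word → Word
powers zero    ρ = ρ
powers (suc N) ρ = ρ ++ R ∷ powers N ρ

runs-powers : ∀ {ℓ ρ} N → Runs ℓ R 1 ρ → Ends U R ρ → Runs ℓ R 1 (powers N ρ)
runs-powers zero    r e = r
runs-powers (suc N) r e = runs-++ r e (runs-powers N r e)

period : Word → List ℕ
period w = 2 ∷ fEntries w

-- The 2 at the head of a period is the entry produced by the seam UR between two copies of the
-- word, so repeated periods are the entries of a power.
fEntries-powers : ∀ N {ρ} → Ends U R ρ →
  period (R ∷ powers N ρ) ≡ concat (replicate (suc N) (period (R ∷ ρ)))
fEntries-powers zero    {ρ} e = sym (++-identityʳ (period (R ∷ ρ)))
fEntries-powers (suc N) {ρ} e = cong (2 ∷_)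
  (trans (fEntries-++ (powers N ρ) e) (cong (fEntries (R ∷ ρ) ++_) (fEntries-powers N e)))

seg-period : ∀ w i → let L = length (period w) in seg (gEntry w) (i * L) L ≡ period w
seg-period w i = seg-nth (gEntry w) (i * length (period w)) (period w)
  (λ j j<L → cong (nth (period w)) (trans ([m+kn]%n≡m%n j i (length (period w))) (m<n⇒m%n≡m j<L)))

seg-periods : ∀ w i N → let L = length (period w) in
  seg (gEntry w) (i * L) (N * L) ≡ concat (replicate N (period w))
seg-periods w i zero    = refl
seg-periods w i (suc N) = let L = length (period w) in
  trans (seg-+ (gEntry w) (i * L) L (N * L))
    (cong₂ _++_ (seg-period w i)
      (trans (cong (λ k → seg (gEntry w) k (N * L)) (+-comm (i * L) L)) (seg-periods w (suc i) N)))

-- The segment starts at index 1 because `cfPQ c 0` has already consumed the head 2 of the first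
-- period.
seg-powers : ∀ N {ρ} → Ends U R ρ → let w = R ∷ ρ in
  seg (gEntry w) 1 (length (fEntries w) + N * length (period w)) ≡ fEntries (R ∷ powers N ρ)
seg-powers N {ρ} e = ∷-injectiveʳ (trans (seg-periods (R ∷ ρ) 0 (suc N)) (sym (fEntries-powers N e)))

all-seg : ∀ {c} → (∀ k → 1 ≤ c k) → ∀ k n → All (1 ≤_) (seg c k n)
all-seg pos k zero    = []
all-seg pos k (suc n) = pos k ∷ all-seg pos (suc k) n

length-seg : ∀ c k n → length (seg c k n) ≡ n
length-seg c k zero    = refl
length-seg c k (suc n) = cong suc (length-seg c (suc k) n)

nth-pos : ∀ {l} → All (1 ≤_) l → ∀ j → j < length l → 1 ≤ nth l j
nth-pos (p ∷ ps) zero    _         = p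
nth-pos (p ∷ ps) (suc j) (s≤s j<n) = nth-pos ps j j<n

gEntry-pos : ∀ w k → 1 ≤ gEntry w k
gEntry-pos w k = nth-pos (s≤s z≤n ∷ fEntries-pos w) (k % length (period w)) (m%n<n k (length (period w)))

convQ-growth : ∀ {c} → (∀ k → 1 ≤ c k) → ∀ k → k ≤ convQ c k
convQ-growth {c} pos k = subst₂ _≤_ (length-seg c 1 k)
  (sym (trans (cong (convQ c) (sym (+-identityʳ k))) (proj₂ (conv-final c 0 k))))
  (length≤finalQ (seg c 1 k) (cfPQ c 0) (all-seg pos 1 k) (s≤s z≤n))

convQ-pos : ∀ {c} → (∀ k → 1 ≤ c k) → ∀ k → 0 < convQ c k
convQ-pos pos zero    = s≤s z≤n
convQ-pos pos (suc k) = ≤-trans (s≤s z≤n) (convQ-growth pos (suc k))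

RatBelow-later : ∀ {c A B} → (∀ k → 1 ≤ c k) → (r : RatBelow c A B) → ∀ n →
  A ℤ.* + convQ c (n + 2 * proj₁ r) ℤ.< + convP c (n + 2 * proj₁ r) ℤ.* + B
RatBelow-later {c} {A} {B} pos (j , h) n =
  subst₂ (λ P Q → A ℤ.* + Q ℤ.< + P ℤ.* + B) (sym (proj₁ cf)) (sym (proj₂ cf))
    (below-final {seg c (suc (2 * j)) n} {cfPQ c (2 * j)} {A} {B} (det-even c j)
      (subst (0 <_) (proj₂ cf) (convQ-pos pos (n + 2 * j))) h)
  where
  cf = conv-final c (2 * j) n

RatAbove-later : ∀ {c A B} → (∀ k → 1 ≤ c k) → (r : RatAbove c A B) → ∀ n →
  + convP c (n + suc (2 * proj₁ r)) ℤ.* + B ℤ.< A ℤ.* + convQ c (n + suc (2 * proj₁ r))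
RatAbove-later {c} {A} {B} pos (j , h) n =
  subst₂ (λ P Q → + P ℤ.* + B ℤ.< A ℤ.* + Q) (sym (proj₁ cf)) (sym (proj₂ cf))
    (above-final {seg c (suc (suc (2 * j))) n} {cfPQ c (suc (2 * j))} {A} {B} (det-odd c j)
      (subst (0 <_) (proj₂ cf) (convQ-pos pos (n + suc (2 * j)))) h)
  where
  cf = conv-final c (suc (2 * j)) n

-- An approximating fraction X / Y is compared with a late convergent P / Q: `small` bounds its
-- error from above, `large` from below, and together they compare m / n with the bound.
Approximable-bound : ∀ {ℓ ρ} (ℓR : 0 < ℓ R) (ℓU : 0 < ℓ U) → Runs ℓ R 1 ρ → Ends U R ρ →
  ∀ m n → Approximable (gEntry (R ∷ ρ)) m n →
  m * proj₂ (lagrangeBound ℓ) ≤ proj₁ (lagrangeBound ℓ) * n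
Approximable-bound {ℓ} {ρ} ℓR ℓU r e m n approx with approx 0
... | X , Y , 0<Y , _ , below@(i , _) , above@(j , _) =
  <⇒≤ (*-cancelʳ-< (Y * E) (m * n₁) (m₁ * n) (begin-strict
    m * n₁ * (Y * E)      ≡⟨ e₁ m n₁ (Y * E) ⟩
    n₁ * (m * (Y * E))    <⟨ *-monoʳ-< n₁ {{>-nonZero n₁-pos}} small ⟩
    n₁ * (n * finalQ l s) ≡⟨ e₂ n₁ n (finalQ l s) ⟩
    n * (n₁ * finalQ l s) ≤⟨ *-monoʳ-≤ n large ⟩
    n * (m₁ * (Y * E))    ≡⟨ e₃ n m₁ (Y * E) ⟩
    m₁ * n * (Y * E)      ∎))
  where
  open ≤-Reasoning
  c = gEntry (R ∷ ρ)
  pos = gEntry-pos (R ∷ ρ)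
  m₁ n₁ N K L : ℕ
  m₁ = proj₁ (lagrangeBound ℓ)
  n₁ = proj₂ (lagrangeBound ℓ)
  L = length (period (R ∷ ρ))
  -- Enough periods to pass both witnesses of the cut, and to make Q exceed Y, since Q is at least
  -- the index of its convergent.
  N = 2 * i + suc (2 * j) + suc Y
  K = length (fEntries (R ∷ ρ)) + N * L
  n₁-pos : 0 < n₁
  n₁-pos = *-mono-≤ (T^0-den (ℓ R)) (T^0-den (ℓ U))
  N≤K : N ≤ K
  N≤K = ≤-trans (m≤m*n N L) (m≤n+m _ _)
  l : List ℕ
  l = fEntries (R ∷ powers N ρ)
  s : State
  s = cfPQ c 0
  E : ℕ
  E = error l s X Y
  at-K : (convP c K ≡ finalP l s) × (convQ c K ≡ finalQ l s)
  at-K = subst₂ (λ k l → (convP c k ≡ finalP l s) × (convQ c k ≡ finalQ l s))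
    (+-identityʳ K) (seg-powers N e) (conv-final c 0 K)
  at : ∀ {k} → k ≤ K → K ∸ k + k ≡ K
  at = m∸n+n≡m
  e₁ : ∀ m n y → m * n * y ≡ n * (m * y)
  e₁ = solveℕ-∀
  e₂ : ∀ n m y → n * (m * y) ≡ m * (n * y)
  e₂ = solveℕ-∀
  e₃ : ∀ n m y → n * (m * y) ≡ m * n * y
  e₃ = solveℕ-∀
  large : n₁ * finalQ l s ≤ m₁ * (Y * E)
  large = admissible⇒badlyApproximable {m₁} {n₁} {l} {s}
    -- At the start the ratio of denominators is 0 / 1, below the 1/2 required after the first R.
    (admissible-runs ℓ ℓR ℓU (runs-powers N r e) z≤n z≤n) refl X Y 0<Y 0<Y
    (≤-trans (m≤n+m (suc Y) (2 * i + suc (2 * j)))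
      (≤-trans N≤K (subst (K ≤_) (proj₂ at-K) (convQ-growth pos K))))
  small : m * (Y * E) < n * finalQ l s
  small = approximation-error {l} {s} {X} m n Y
    (subst₂ (λ P Q → A₋ ℤ.* + Q ℤ.< + P ℤ.* + B) (proj₁ at-K) (proj₂ at-K)
      (subst (λ k → A₋ ℤ.* + convQ c k ℤ.< + convP c k ℤ.* + B)
        (at (≤-trans (≤-trans (m≤m+n (2 * i) _) (m≤m+n _ (suc Y))) N≤K))
        (RatBelow-later {c} {A₋} {B} pos below (K ∸ 2 * i))))
    (subst₂ (λ P Q → + P ℤ.* + B ℤ.< A₊ ℤ.* + Q) (proj₁ at-K) (proj₂ at-K)
      (subst (λ k → + convP c k ℤ.* + B ℤ.< A₊ ℤ.* + convQ c k)
        (at (≤-trans (≤-trans (m≤n+m (suc (2 * j)) (2 * i)) (m≤m+n _ (suc Y))) N≤K))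
        (RatAbove-later {c} {A₊} {B} pos above (K ∸ suc (2 * j)))))
    where
    A₋ A₊ : ℤ
    A₋ = X ℤ.* + m ℤ.* + Y ℤ.- + n
    A₊ = X ℤ.* + m ℤ.* + Y ℤ.+ + n
    B : ℕ
    B = m * Y * Y

-- Good approximations for the sorted word

ones : ℕ → List ℕ → List ℕ
ones zero    l = l
ones (suc n) l = 1 ∷ 1 ∷ ones n l

ones-++ : ∀ n l l' → ones n l ++ l' ≡ ones n (l ++ l')
ones-++ zero    l l' = refl
ones-++ (suc n) l l' = cong (λ l → 1 ∷ 1 ∷ l) (ones-++ n l l')

fr-ones : ∀ n l → fr (ones n l) ≡ T^ n (fr l)
fr-ones zero    l = refl
fr-ones (suc n) l = cong T (fr-ones n l)

ratio-ones : ∀ n l s → ∃ λ s' → steps (ones n l) s ≡ steps l s' × ratio s' ≡ T^ n (ratio s)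
ratio-ones zero    l s = s , refl , refl
ratio-ones (suc n) l s with ratio-ones n l (step 1 (step 1 s))
... | s' , eq , ratio-eq = s' , eq , trans ratio-eq (T^-T n (ratio s))

length-ones : ∀ n l → length (ones n l) ≡ 2 * n + length l
length-ones zero    l = refl
length-ones (suc n) l = trans (cong (λ k → 2 + k) (length-ones n l)) (e n (length l))
  where
  e : ∀ n k → 2 + (2 * n + k) ≡ 2 * suc n + k
  e = solveℕ-∀

fEntries-replicate : ∀ s n W → fEntries (s ∷ replicate n s ++ W) ≡ ones n (fEntries (s ∷ W))
fEntries-replicate s zero    W = refl
fEntries-replicate s (suc n) W = trans (fEntries-same s (replicate n s ++ W))
  (cong (λ l → 1 ∷ 1 ∷ l) (fEntries-replicate s n W))

fEntries-omegaAB : ∀ a b → fEntries (omegaAB (suc a) (suc b)) ≡ ones a (2 ∷ ones b [])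
fEntries-omegaAB a b = trans (fEntries-replicate R a (replicate (suc b) U))
  (cong (λ l → ones a (2 ∷ l)) (trans (cong (λ V → fEntries (U ∷ V)) (sym (++-identityʳ (replicate b U))))
    (fEntries-replicate U b [])))

det⇒coprime : ∀ s → det s ≡ -[1+ 0 ] → Coprime (proj₁ (proj₂ s)) (proj₂ (proj₂ s))
det⇒coprime ((p' , q') , (p , q)) eq {d} (d∣p , d∣q) =
  ∣1⇒≡1 (∣m+n∣m⇒∣n (subst (d ∣_) (ℤ.+-injective pq'≡) (∣m⇒∣m*n q' d∣p)) (∣n⇒∣m*n p' d∣q))
  where
  e : ∀ x y → x ≡ y ℤ.- (y ℤ.- x)
  e = solveℤ-∀
  pq'≡ : + (p * q') ≡ + (p' * q + 1)
  pq'≡ = trans (ℤ.pos-* p q') (trans (e (+ p ℤ.* + q') (+ p' ℤ.* + q))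
    (trans (cong₂ (λ x D → x ℤ.- D) (sym (ℤ.pos-* p' q)) eq) (sym (ℤ.pos-+ (p' * q) 1))))

-- An odd convergent s lies above the value, by num l / (q Q) as measured at the later convergent P / Q.
odd-RatBelow : ∀ l s m n → det s ≡ -[1+ 0 ] → let _ , (p , q) = s in m * (q * num l) < n * finalQ l s →
  (+ p ℤ.* + m ℤ.* + q ℤ.- + n) ℤ.* + finalQ l s ℤ.< + finalP l s ℤ.* + (m * q * q)
odd-RatBelow l s@(_ , (p , q)) m n odd h =
  subst₂ ℤ._<_ (e₁ (+ m) (+ q) (+ num l) (+ p) (+ n) (+ Q)) e₂
    (ℤ.+-monoˡ-< (+ p ℤ.* + m ℤ.* + q ℤ.* + Q ℤ.- + m ℤ.* (+ q ℤ.* + num l) ℤ.- + n ℤ.* + Q)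
      (subst₂ ℤ._<_ (trans (ℤ.pos-* m (q * num l)) (cong (+ m ℤ.*_) (ℤ.pos-* q (num l)))) (ℤ.pos-* n Q) (ℤ.+<+ h)))
  where
  P Q : ℕ
  P = finalP l s
  Q = finalQ l s
  e₁ : ∀ m q k p n Q → m ℤ.* (q ℤ.* k) ℤ.+ (p ℤ.* m ℤ.* q ℤ.* Q ℤ.- m ℤ.* (q ℤ.* k) ℤ.- n ℤ.* Q)
    ≡ (p ℤ.* m ℤ.* q ℤ.- n) ℤ.* Q
  e₁ = solveℤ-∀
  e₃ : ∀ m q k p n Q → n ℤ.* Q ℤ.+ (p ℤ.* m ℤ.* q ℤ.* Q ℤ.- m ℤ.* (q ℤ.* k) ℤ.- n ℤ.* Q)
    ≡ (p ℤ.* Q ℤ.+ k ℤ.* (ℤ.- + 1)) ℤ.* (m ℤ.* q)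
  e₃ = solveℤ-∀
  e₄ : ∀ P q m → P ℤ.* q ℤ.* (m ℤ.* q) ≡ P ℤ.* (m ℤ.* q ℤ.* q)
  e₄ = solveℤ-∀
  e₂ : + n ℤ.* + Q ℤ.+ (+ p ℤ.* + m ℤ.* + q ℤ.* + Q ℤ.- + m ℤ.* (+ q ℤ.* + num l) ℤ.- + n ℤ.* + Q)
       ≡ + P ℤ.* + (m * q * q)
  e₂ = trans (e₃ (+ m) (+ q) (+ num l) (+ p) (+ n) (+ Q))
    (trans (cong (ℤ._* (+ m ℤ.* + q))
      (sym (trans (final-det l s) (cong (λ D → + p ℤ.* + Q ℤ.+ + num l ℤ.* D) odd))))
    (trans (e₄ (+ P) (+ q) (+ m)) (cong (+ P ℤ.*_)
      (sym (trans (ℤ.pos-* (m * q) q) (cong (ℤ._* + q) (ℤ.pos-* m q)))))))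

-- As `num (2 ∷ l)` is `den l`, the quotient of `finalQ (2 ∷ l) s` by q `den l` is 2 + [0; l] + q' /
-- q, which exceeds 2 + x + y term by term.
twoPlus-below : ∀ {x y} l s → 0 < proj₂ y → 0 < proj₂ (proj₂ s) → x ≺ fr l → y ≼ ratio s →
  proj₁ (twoPlus x y) * (proj₂ (proj₂ s) * num (2 ∷ l)) < proj₂ (twoPlus x y) * finalQ (2 ∷ l) s
twoPlus-below {n , d} {n' , d'} l ((_ , q') , (_ , q)) 0<d' 0<q h k = begin-strict
  (2 * (d * d') + n * d' + n' * d) * (q * e)
    ≡⟨ e₁ d d' e q n n' ⟩
  2 * (d * d') * (q * e) + d * e * (n' * q) + d' * q * (n * e)
    ≤⟨ +-monoˡ-≤ _ (+-monoʳ-≤ (2 * (d * d') * (q * e)) (*-monoʳ-≤ (d * e) k)) ⟩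
  2 * (d * d') * (q * e) + d * e * (q' * d') + d' * q * (n * e)
    <⟨ +-monoʳ-< (2 * (d * d') * (q * e) + d * e * (q' * d'))
        (*-monoʳ-< (d' * q) {{>-nonZero (*-mono-≤ 0<d' 0<q)}} h) ⟩
  2 * (d * d') * (q * e) + d * e * (q' * d') + d' * q * (f * d)
    ≡⟨ e₂ d d' e q q' f ⟩
  d * d' * ((2 * e + f) * q + e * q') ∎
  where
  open ≤-Reasoning
  e f : ℕ
  e = den l
  f = num l
  e₁ : ∀ d d' e q n n' → (2 * (d * d') + n * d' + n' * d) * (q * e)
     ≡ 2 * (d * d') * (q * e) + d * e * (n' * q) + d' * q * (n * e)
  e₁ = solveℕ-∀
  e₂ : ∀ d d' e q q' f → 2 * (d * d') * (q * e) + d * e * (q' * d') + d' * q * (f * d)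
     ≡ d * d' * ((2 * e + f) * q + e * q')
  e₂ = solveℕ-∀

twoPlus-mono-≺ : ∀ {x y z} → 0 < proj₂ x → y ≺ z → twoPlus x y ≺ twoPlus x z
twoPlus-mono-≺ {n , d} {f , e} {f' , e'} 0<d h =
  subst₂ _<_ (e₁ n d f e e') (e₁ n d f' e' e)
    (subst (λ k → d * d * (f * e') + k < d * d * (f' * e) + (2 * d + n) * d * (e' * e))
      (cong ((2 * d + n) * d *_) (*-comm e' e))
      (+-monoˡ-< ((2 * d + n) * d * (e' * e)) (*-monoʳ-< (d * d) {{>-nonZero (*-mono-≤ 0<d 0<d)}} h)))
  where
  e₁ : ∀ n d f e e' → d * d * (f * e') + (2 * d + n) * d * (e * e')
    ≡ (2 * (d * e) + n * e + f * d) * (d * e')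
  e₁ = solveℕ-∀

-- 1/3 is the least value of 1 / (2 + x) for 0 ≤ x ≤ 1.
maxRatio : ℕ → Fraction
maxRatio b = T^ b (1 , 3)

maxBound : ℕ → ℕ → Fraction
maxBound a b = twoPlus (T^0 a) (maxRatio b)

module _ (a b : ℕ) (0<a : 0 < a) where

  private
    ω : Word
    ω = omegaAB (suc a) (suc b)
    c : ℕ → ℕ
    c = gEntry ω
    L : ℕ
    L = length (period ω)

  length-fEntries-ω : length (fEntries ω) ≡ suc (2 * (a + b))
  length-fEntries-ω = trans (cong length (fEntries-omegaAB a b))
    (trans (length-ones a _) (trans (cong (λ k → 2 * a + suc k) (length-ones b [])) (e a b)))
    where
    e : ∀ a b → 2 * a + suc (2 * b + 0) ≡ suc (2 * (a + b))
    e = solveℕ-∀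

  -- `index N` is the last position of a period, so the next entry is a head 2. The period has even
  -- length, so this position is odd, equal to 2 `half N` + 1.
  index half : ℕ → ℕ
  index N = length (fEntries ω) + N * L
  half N = (a + b) + N * suc (a + b)

  index-odd : ∀ N → index N ≡ suc (2 * half N)
  index-odd N = trans (cong (λ k → k + N * suc k) length-fEntries-ω) (e (a + b) N)
    where
    e : ∀ h N → suc (2 * h) + N * suc (suc (2 * h)) ≡ suc (2 * (h + N * suc h))
    e = solveℕ-∀

  -- Read backwards, a period ends with b pairs 1, 1 and a 2 before them. Behind that 2 there is a
  -- further pair as a > 0, so the tail there is at most 1.
  ratio-index : ∀ N → maxRatio b ≼ ratio (cfPQ c (index N))
  ratio-index N = subst (λ s → maxRatio b ≼ ratio s)
    (sym (trans (cfPQ-seg c (N * L) (length (fEntries ω)))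
      (cong (λ l → steps l (cfPQ c (N * L)))
        (trans (∷-injectiveʳ (seg-period ω N)) (fEntries-omegaAB a b)))))
    bound
    where
    s₀ : State
    s₀ = cfPQ c (N * L)
    ones-≤ : ∀ {a} → 0 < a → ∀ x → proj₁ (T^ a x) ≤ proj₂ (T^ a x)
    ones-≤ {suc a} _ x = ≤-trans (m≤m+n _ 0) (m≤m+n _ _)
    third : ∀ {x} → proj₁ x ≤ proj₂ x → (1 , 3) ≼ cstep 2 x
    third {n , d} h = ≤-trans (≤-reflexive (*-identityˡ (2 * d + n)))
      (≤-trans (+-monoʳ-≤ (2 * d) h) (≤-reflexive (e d)))
      where
      e : ∀ d → 2 * d + d ≡ d * 3
      e = solveℕ-∀
    bound : maxRatio b ≼ ratio (steps (ones a (2 ∷ ones b [])) s₀)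
    bound with ratio-ones a (2 ∷ ones b []) s₀
    ... | s₁ , eq₁ , r₁ with ratio-ones b [] (step 2 s₁)
    ...   | s₂ , eq₂ , r₂ = subst (maxRatio b ≼_) (sym (trans (cong ratio (trans eq₁ eq₂)) r₂))
      (T^-mono b {1 , 3} {cstep 2 (ratio s₁)}
        (third {ratio s₁} (subst (λ x → proj₁ x ≤ proj₂ x) (sym r₁) (ones-≤ 0<a (ratio s₀)))))

  -- A period without its head, followed by the head of the next one. This last 2 gives the later
  -- convergent an even index, as `RatBelow` demands.
  tail : List ℕ
  tail = ones a (2 ∷ ones b [ 2 ])

  tail-bound : T^0 a ≺ fr tail
  tail-bound = subst (T^0 a ≺_) (sym (fr-ones a (2 ∷ ones b [ 2 ])))
    (T^-mono-≺ a {0 , 1} {cstep 2 (fr (ones b [ 2 ]))}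
      (≤-trans (subst (λ x → 0 < proj₂ x) (sym (fr-ones b [ 2 ])) (T^-den b (1 , 2) (s≤s z≤n)))
        (≤-reflexive (sym (*-identityʳ _)))))

  seg-index : ∀ N → seg c (suc (index N)) (L + 1) ≡ 2 ∷ tail
  seg-index N = trans (seg-+ c (suc N * L) L 1)
    (trans (cong₂ _++_ (seg-period ω (suc N))
        (trans (cong (λ k → seg c k 1) (+-comm (suc N * L) L)) (cong [_] (cong (nth (period ω)) ([m+kn]%n≡m%n 0 (suc (suc N)) L)))))
      (cong (2 ∷_) (trans (cong (_++ [ 2 ]) (fEntries-omegaAB a b))
        (trans (ones-++ a (2 ∷ ones b []) [ 2 ]) (cong (λ l → ones a (2 ∷ l)) (ones-++ b [] [ 2 ]))))))

  -- The fractions are the convergents at `index N`. They lie above the limit, so each is its own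
  -- witness for the upper comparison; the lower one uses a convergent just over a period later.
  omegaAB-Approximable : Approximable c (proj₁ (maxBound a b)) (proj₂ (maxBound a b))
  omegaAB-Approximable N = + p , q , N<q , det⇒coprime s odd ,
    (j , subst (λ K → A₋ ℤ.* + convQ c K ℤ.< + convP c K ℤ.* + B) later-even below) ,
    (half N , subst (λ K → + convP c K ℤ.* + B ℤ.< A₊ ℤ.* + convQ c K) (index-odd N) above)
    where
    pos = gEntry-pos ω
    k m n p q j : ℕ
    k = index N
    m = proj₁ (maxBound a b)
    n = proj₂ (maxBound a b)
    s : State
    s = cfPQ c k
    p = convP c k
    q = convQ c k
    j = half N + suc (suc (a + b))
    A₋ A₊ : ℤ
    A₋ = + p ℤ.* + m ℤ.* + q ℤ.- + n
    A₊ = + p ℤ.* + m ℤ.* + q ℤ.+ + n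
    B : ℕ
    B = m * q * q
    N<q : N < q
    N<q = ≤-trans (s≤s (≤-trans (m≤m*n N (suc (a + b))) (≤-trans (m≤n+m _ (a + b)) (m≤m+n (half N) _))))
      (subst (_≤ q) (index-odd N) (convQ-growth pos k))
    0<q : 0 < q
    0<q = convQ-pos pos k
    odd : det s ≡ -[1+ 0 ]
    odd = trans (cong (det ∘ cfPQ c) (index-odd N)) (det-odd c (half N))
    later-even : (L + 1) + k ≡ 2 * j
    later-even = trans (cong₂ (λ x y → suc x + 1 + y) length-fEntries-ω (index-odd N)) (e (half N) (a + b))
      where
      e : ∀ h x → suc (suc (2 * x)) + 1 + suc (2 * h) ≡ 2 * (h + suc (suc x))
      e = solveℕ-∀
    0<n : 0 < n
    0<n = *-mono-≤ (T^0-den a) (T^-den b (1 , 3) (s≤s z≤n))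
    below : A₋ ℤ.* + convQ c (L + 1 + k) ℤ.< + convP c (L + 1 + k) ℤ.* + B
    below = subst₂ (λ P Q → A₋ ℤ.* + Q ℤ.< + P ℤ.* + B)
      (sym (trans (proj₁ (conv-final c k (L + 1))) (cong (λ l → finalP l s) (seg-index N))))
      (sym (trans (proj₂ (conv-final c k (L + 1))) (cong (λ l → finalQ l s) (seg-index N))))
      (odd-RatBelow (2 ∷ tail) s m n odd
        (twoPlus-below {T^0 a} {maxRatio b} tail s (T^-den b (1 , 3) (s≤s z≤n)) 0<q tail-bound (ratio-index N)))
    above : + p ℤ.* + B ℤ.< A₊ ℤ.* + q
    above = subst₂ ℤ._<_ left right (ℤ.+<+ (m<m+n (p * B) (*-mono-≤ 0<n 0<q)))
      where
      left : + (p * B) ≡ + p ℤ.* + B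
      left = ℤ.pos-* p B
      e : ∀ p m q n → p ℤ.* (m ℤ.* q ℤ.* q) ℤ.+ n ℤ.* q ≡ (p ℤ.* m ℤ.* q ℤ.+ n) ℤ.* q
      e = solveℤ-∀
      right : + (p * B + n * q) ≡ A₊ ℤ.* + q
      right = trans (sym (pos-lin p B n q))
        (trans (cong (λ x → + p ℤ.* x ℤ.+ + n ℤ.* + q) (trans (ℤ.pos-* (m * q) q) (cong (ℤ._* + q) (ℤ.pos-* m q))))
          (e (+ p) (+ m) (+ q) (+ n)))

-- Comparison of the Lagrange numbers and conclusion

L-lt : ∀ {a b w} → 0 < b → b < a → InD a b w → w ≢ omegaAB a b → w <L omegaAB a b
L-lt {suc a} {suc b} 0<b (s≤s b<a) D w≢ω with InD-shape 0<b (s≤s b<a) D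
L-lt {suc a} {suc b} 0<b (s≤s b<a) (r≡a , u≡b , _) w≢ω | V , refl =
  proj₁ B₁ , proj₂ B₁ , proj₁ B₂ , proj₂ B₂ ,
  ≤-trans 0<n₁ (≤-trans (m≤n*m (proj₂ B₁) 3) (lagrangeBound≥3 ℓ 0<a ℓU)) , 0<n₁ ,
  ≤-trans (*-mono-≤ (s≤s (z≤n {1})) 0<n₂) (≤-trans (m≤m+n _ _) (m≤m+n _ _)) , 0<n₂ ,
  -- The two bounds differ only in the last summand, T^b 0 against T^b (1/3).
  twoPlus-mono-≺ {T^0 a} {T^0 b} {maxRatio b} (T^0-den a) (T^-mono-≺ b {0 , 1} {1 , 3} (s≤s z≤n)) ,
  omegaAB-Approximable a b 0<a ,
  λ m n _ _ → Approximable-bound {ℓ} 0<a ℓU runs ends m n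
  where
  ℓ = bounds a b
  0<a : 0 < a
  0<a = ≤-<-trans z≤n b<a
  ρ : Word
  ρ = R ∷ V ++ [ U ]
  ends : Ends U R ρ
  ends = ends-snoc R (R ∷ V)
  runs : Runs ℓ R 1 ρ
  runs = runs-first-R a b ρ ends (s≤s z≤n) r≡a u≡b w≢ω
  -- The final run of U has at least one letter and, by `runs`, at most b.
  ℓU : 0 < ℓ U
  ℓU = runs-U-pos runs ends
  B₁ B₂ : Fraction
  B₁ = lagrangeBound ℓ
  B₂ = maxBound a b
  0<n₁ : 0 < proj₂ B₁
  0<n₁ = *-mono-≤ (T^0-den a) (T^0-den b)
  0<n₂ : 0 < proj₂ B₂
  0<n₂ = *-mono-≤ (T^0-den a) (T^-den b (1 , 3) (s≤s z≤n))

theorem1p5 : (a b : ℕ) → 0 < b → b < a → Coprime a b →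
    InD a b (omegaAB a b)
    × ((w : Word) → InD a b w → w ≢ omegaAB a b →
    (M w < M (omegaAB a b)) × (w <L omegaAB a b))
theorem1p5 a b 0<b b<a _ = omegaAB-InD a b , λ w D w≢ω → M-lt 0<b b<a D w≢ω , L-lt 0<b b<a D w≢ω
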